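{- For every graph $F$ and every integer $m\ge 0$, there exists a constant $M$ such that the following holds. Let $G$ be a graph and $X\subseteq V(G)$ a set of its vertices such that no two vertices of $X$ are separated by an edge cut of size less than $M$ in $G$. Let $G_X$ be the graph with vertex set $X$ in which two vertices $u,v\in X$ are adjacent if $G$ contains $m$ pairwise edge-disjoint paths joining $u$ with $v$ and otherwise disjoint from $X$ (that is, no internal vertex of these paths belongs to $X$). If $G$ does not contain $F$ as a strong immersion, then $G_X$ is connected.
   Context: Graphs are finite and may have parallel edges and loops; each loop contributes $2$ to the degree of its vertex. An immersion of a graph $H$ in a graph $G$ is a function $\theta$ on the vertices and edges of $H$ such that: (a) $\theta(v)$ is a vertex of $G$ for each $v\in V(H)$, and $\theta$ restricted to $V(H)$ is injective; (b) $\theta(e)$ is a connected subgraph of $G$ for each $e\in E(H)$, and for distinct $e,f\in E(H)$ the subgraphs $\theta(e)$ and $\theta(f)$ are edge-disjoint; (c) if $e\in E(H)$ is incident with $v\in V(H)$, then $\theta(v)$ is a vertex of $\theta(e)$, and if $e$ is a loop, then $\theta(e)$ contains a cycle passing through $\theta(v)$. The immersion is strong if, in addition, whenever $e\in E(H)$ is not incident with $v\in V(H)$, $\theta(e)$ does not contain $\theta(v)$. "$G$ contains $F$ as a strong immersion" means that there is a strong immersion of $F$ in $G$. -}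

module Defs where

open import Data.Bool.Base using (_xor_)
open import Data.Fin.Base using (Fin)
open import Data.Fin.Subset using (Subset; _∈_; _∉_; ∣_∣)
open import Data.List.Base using (List; []; _∷_)
open import Data.List.Membership.Propositional using () renaming (_∈_ to _∈ˡ_)
open import Data.List.Relation.Binary.Disjoint.Propositional using (Disjoint)
open import Data.List.Relation.Unary.All using (All)
open import Data.List.Relation.Unary.Unique.Propositional using (Unique)
open import Data.Nat.Base using (ℕ; _<_)
open import Data.Product.Base using (_×_; _,_; ∃-syntax; proj₁; proj₂)
open import Data.Sum.Base using (_⊎_)
open import Data.Vec.Base using (lookup; tabulate)
open import Function.Definitions using (Injective)
open import Level using (0ℓ)
open import Relation.Binary.Core using (Rel)
open import Relation.Binary.Construct.Closure.ReflexiveTransitive using (Star)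
open import Relation.Binary.PropositionalEquality using (_≡_; _≢_)
open import Relation.Nullary.Negation using (¬_)

-- The two ends of an edge are stored as a pair, but every notion below
-- ignores their order.
record Graph : Set where
  field
    #V   : ℕ
    #E   : ℕ
    ends : Fin #E → Fin #V × Fin #V

  V : Set
  V = Fin #V

  E : Set
  E = Fin #E

  Joins : E → V → V → Set
  Joins e u v = ends e ≡ (u , v) ⊎ ends e ≡ (v , u)

  Incident : E → V → Set
  Incident e v = v ≡ proj₁ (ends e) ⊎ v ≡ proj₂ (ends e)

  IsLoop : E → Set
  IsLoop e = proj₁ (ends e) ≡ proj₂ (ends e)

open Graph public using (V; E)

-- Connectedness of the graph with vertex set S and adjacency R; R is only
-- used with relations whose related pairs lie in S.  The graph without
-- vertices counts as connected.
Connected : ∀ {n} → Subset n → Rel (Fin n) 0ℓ → Set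
Connected S R = ∀ {u v} → u ∈ S → v ∈ S → Star R u v

module _ (G : Graph) where
  open Graph G hiding (V; E)

  record Subgraph : Set where
    field
      vertices : Subset #V
      edges    : Subset #E
      closed   : ∀ {e v} → e ∈ edges → Incident e v → v ∈ vertices

    Adjacent : Rel (V G) 0ℓ
    Adjacent u v = ∃[ e ] e ∈ edges × Joins e u v

    IsConnected : Set
    IsConnected = Connected vertices Adjacent

  data Walk : V G → V G → Set where
    nil  : ∀ {u} → Walk u u
    step : ∀ {u w v} (e : E G) → Joins e u w → Walk w v → Walk u v

module _ {G : Graph} where
  open Graph G hiding (V; E)

  walkEdges : ∀ {u v} → Walk G u v → List (E G)
  walkEdges nil          = []
  walkEdges (step e _ p) = e ∷ walkEdges p

  walkVertices : ∀ {u v} → Walk G u v → List (V G)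
  walkVertices {u} nil          = u ∷ []
  walkVertices {u} (step _ _ p) = u ∷ walkVertices p

  IsPath : ∀ {u v} → Walk G u v → Set
  IsPath p = Unique (walkVertices p)

  -- A cycle through v: traverse the edge e from v to w, then return to v along
  -- a path not using e.  A loop (w = v, trivial return path) and a pair of
  -- parallel edges both form cycles; going back along e itself does not.
  record CycleThrough (v : V G) : Set where
    field
      {w}      : V G
      e        : E G
      joins    : Joins e v w
      back     : Walk G w v
      isPath   : IsPath back
      notAgain : ¬ (e ∈ˡ walkEdges back)

    cycleEdges : List (E G)
    cycleEdges = e ∷ walkEdges back

  -- Enough to ask for the edges: every vertex of a cycle is an end of one.
  ContainsCycleThrough : Subgraph G → V G → Set
  ContainsCycleThrough S v =
    ∃[ c ] All (_∈ Subgraph.edges S) (CycleThrough.cycleEdges {v} c)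

  EdgeDisjoint : Subgraph G → Subgraph G → Set
  EdgeDisjoint S T = ∀ {e} → e ∈ Subgraph.edges S → e ∉ Subgraph.edges T

record Immersion (H G : Graph) : Set where
  open Graph H using (Incident; IsLoop)
  field
    θᵛ           : V H → V G
    θᵉ           : E H → Subgraph G
    injective    : Injective _≡_ _≡_ θᵛ
    connected    : ∀ e → Subgraph.IsConnected (θᵉ e)
    edgeDisjoint : ∀ {e f} → e ≢ f → EdgeDisjoint (θᵉ e) (θᵉ f)
    incident     : ∀ {e v} → Incident e v → θᵛ v ∈ Subgraph.vertices (θᵉ e)
    loop         : ∀ {e v} → Incident e v → IsLoop e →
                   ContainsCycleThrough (θᵉ e) (θᵛ v)

record StrongImmersion (H G : Graph) : Set where
  field
    immersion : Immersion H G
  open Immersion immersion public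
  field
    strong : ∀ {e v} → ¬ Graph.Incident H e v →
             θᵛ v ∉ Subgraph.vertices (θᵉ e)

module _ (G : Graph) where
  open Graph G hiding (V; E)

  -- The edge cut determined by the bipartition (A , V ∖ A): the edges with
  -- exactly one end in A.
  δ : Subset #V → Subset #E
  δ A = tabulate λ e → lookup A (proj₁ (ends e)) xor lookup A (proj₂ (ends e))

  SeparatedByCutBelow : ℕ → V G → V G → Set
  SeparatedByCutBelow M u v = ∃[ A ] u ∈ A × v ∉ A × ∣ δ A ∣ < M

  record XPath (X : Subset #V) (u v : V G) : Set where
    field
      walk     : Walk G u v
      isPath   : IsPath walk
      internal : ∀ {w} → w ∈ˡ walkVertices walk → w ≢ u → w ≢ v → w ∉ X

  record GXAdjacent (m : ℕ) (X : Subset #V) (u v : V G) : Set where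
    field
      u∈X      : u ∈ X
      v∈X      : v ∈ X
      u≢v      : u ≢ v
      paths    : Fin m → XPath X u v
      disjoint : ∀ {i j} → i ≢ j → Disjoint (walkEdges (XPath.walk (paths i)))
                                            (walkEdges (XPath.walk (paths j)))

  GXConnected : ℕ → Subset #V → Set
  GXConnected m X = Connected X (GXAdjacent m X)

{-# OPTIONS --safe #-}
-- Fix a width larger than m and than twice the number of edges of F.  A spanning tree of X whose edges
-- are G_X-adjacencies of that width is grown from a root.  If v ∈ X is not yet in the tree τ, there are
-- many edge-disjoint walks from the root to v; cut each of them at its last vertex b in τ and at the
-- next vertex x in X.  If many of them share both b and x, then x can be attached to b.  Otherwise a
-- "hub" arises: many edge-disjoint walks from distinct nodes of a tree to a vertex c outside it, which
-- meet the tree only where they start.  If there are many different b, the tree is τ and c = v; if many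
-- walks share b but there are many different x, then c = b, and the tree spans X − b by induction on
-- the size of X.
--
-- A hub yields the strong immersion.  Choose one tree node for each vertex of F in such a way that from
-- each chosen node t many starting points of walks are reached in the tree without entering the other
-- chosen nodes: either cut off subtrees with many starting points one after the other, or take children
-- of a vertex with many children.  A set that contains t but not c then has many outgoing edges that
-- avoid the chosen nodes: it either contains all these starting points or cuts a tree edge, which
-- stands for many paths.  By Menger's theorem, edge-disjoint walks to c that enter no chosen node can be
-- started at the chosen nodes, one for each end of each edge of F; an edge of F is mapped to the union
-- of its two walks.
--
-- Menger's theorem is proved by uncrossing: each edge can be oriented so that the cut condition is kept,
-- and then the tokens are moved to c one arc at a time.
module Submission where

open import Data.Bool.Base using (Bool; true; false; _∧_; _∨_; not; _xor_)
import Data.Bool.Properties as Bool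
open import Data.Fin.Base as Fin using (Fin; zero; suc; _↑ˡ_; _↑ʳ_)
import Data.Fin.Properties as Fin
open import Data.Fin.Subset as Subset using (Subset; _∈_; _∉_; ∣_∣)
import Data.Fin.Subset.Properties as Subset
open import Data.List.Base as List using (List; []; _∷_; _++_; map; length; filter; tabulate; allFin)
import Data.List.Properties as List
import Data.List.Membership.DecPropositional as DecMembership
open import Data.List.Membership.Propositional using () renaming (_∈_ to _∈ˡ_; _∉_ to _∉ˡ_)
open import Data.List.Membership.Propositional.Properties
open import Data.List.Relation.Binary.Disjoint.Propositional using (Disjoint)
open import Data.List.Relation.Binary.Permutation.Propositional using (_↭_; ↭-trans; ↭-sym; ↭-reflexive; ↭⇒↭ₛ)
open import Data.List.Relation.Binary.Permutation.Propositional.Properties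
  using (++⁺ˡ; ++⁺ʳ; ++-comm; shifts; ↭-length; filter-↭; ∈-resp-↭)
import Data.List.Relation.Binary.Permutation.Setoid.Properties as Permutation
open import Data.List.Relation.Binary.Subset.Propositional using (_⊆_)
open import Data.List.Relation.Unary.All as All using (All; []; _∷_)
open import Data.List.Relation.Unary.Any using (here; there)
open import Data.List.Relation.Unary.AllPairs as AllPairs using (AllPairs; []; _∷_)
import Data.List.Relation.Unary.AllPairs.Properties as AllPairs
open import Data.List.Relation.Unary.Unique.Propositional using (Unique)
import Data.List.Relation.Unary.Unique.Propositional.Properties as Unique
open import Data.Nat.Base using (ℕ; zero; suc; _+_; _*_; _≤_; _<_; z≤n; s≤s)
open import Data.Nat.ListAction using (sum)
open import Data.Nat.Properties as ℕ using (module ≤-Reasoning)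
open import Data.Nat.Tactic.RingSolver using (solve-∀)
open import Data.Product.Base using (_×_; _,_; ∃-syntax; Σ-syntax; proj₁; proj₂)
open import Data.Sum.Base as Sum using (_⊎_; inj₁; inj₂)
open import Data.Unit.Base using (⊤)
import Data.Vec.Base as Vec
import Data.Vec.Properties as Vec
open import Data.Vec.Functional using () renaming (_∷_ to _∷ᶠ_)
open import Function.Base using (_∘_; id; const)
open import Level using (0ℓ)
open import Relation.Binary.Core using (Rel)
open import Relation.Binary.Construct.Closure.ReflexiveTransitive as Star using (Star; ε; _◅_; _◅◅_)
open import Relation.Binary.PropositionalEquality
open import Relation.Nullary using (¬_; Dec; yes; no; does; contradiction)
open import Relation.Nullary.Decidable using (_×-dec_; ¬?; dec-true; dec-false; toWitness; _→-dec_)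
open import Defs

private variable
  A B : Set
  n k : ℕ

infix 4 _∈ˡ?_
_∈ˡ?_ : (v : Fin n) (xs : List (Fin n)) → Dec (v ∈ˡ xs)
_∈ˡ?_ = DecMembership._∈?_ Fin._≟_

⟦_⟧ : Bool → ℕ
⟦ true  ⟧ = 1
⟦ false ⟧ = 0

⟦⟧≤1 : ∀ b → ⟦ b ⟧ ≤ 1
⟦⟧≤1 true  = s≤s z≤n
⟦⟧≤1 false = z≤n

-- Weighted counting in lists

total : (A → ℕ) → List A → ℕ
total h xs = sum (map h xs)

total-++ : (h : A → ℕ) (xs ys : List A) → total h (xs ++ ys) ≡ total h xs + total h ys
total-++ h []       ys = refl
total-++ h (x ∷ xs) ys = trans (cong (h x +_) (total-++ h xs ys)) (sym (ℕ.+-assoc (h x) _ _))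

total-mono : ∀ (h : A → ℕ) {xs ys} → Unique xs → xs ⊆ ys → total h xs ≤ total h ys
total-mono h {[]}     _          _  = z≤n
total-mono h {x ∷ xs} (x∉ ∷ uxs) xs⊆ with ∈-∃++ (xs⊆ (here refl))
... | as , bs , refl = begin
  h x + total h xs                 ≤⟨ ℕ.+-monoʳ-≤ (h x) (total-mono h uxs xs⊆′) ⟩
  h x + total h (as ++ bs)         ≡⟨ cong (h x +_) (total-++ h as bs) ⟩
  h x + (total h as + total h bs)  ≡⟨ swap (h x) (total h as) _ ⟩
  total h as + (h x + total h bs)  ≡⟨ total-++ h as (x ∷ bs) ⟨
  total h (as ++ x ∷ bs)           ∎
  where
  open ≤-Reasoning
  swap : ∀ a b c → a + (b + c) ≡ b + (a + c)
  swap = solve-∀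
  xs⊆′ : xs ⊆ as ++ bs
  xs⊆′ {y} y∈ with ∈-++⁻ as (xs⊆ (there y∈))
  ... | inj₁ y∈as         = ∈-++⁺ˡ y∈as
  ... | inj₂ (here refl)  = contradiction refl (All.lookup x∉ y∈)
  ... | inj₂ (there y∈bs) = ∈-++⁺ʳ as y∈bs

length≡total : (xs : List A) → length xs ≡ total (const 1) xs
length≡total []       = refl
length≡total (x ∷ xs) = cong suc (length≡total xs)

length-mono : {xs ys : List A} → Unique xs → xs ⊆ ys → length xs ≤ length ys
length-mono {xs = xs} {ys} u s =
  subst₂ _≤_ (sym (length≡total xs)) (sym (length≡total ys)) (total-mono (const 1) u s)

-- Used with `x` standing for one of several edge-disjoint walks and `y` for an edge of it that
-- crosses a cut. Every `x` picks such a `y`; no `y` is picked twice, so the picks form a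
-- duplicate-free part of `ys`.
length≤total : (h : B → ℕ) (P : A → B → Set) {xs : List A} {ys : List B} → Unique xs →
  (∀ {x x′ y} → x ≢ x′ → P x y → ¬ P x′ y) →
  (∀ {x} → x ∈ˡ xs → ∃[ y ] y ∈ˡ ys × 1 ≤ h y × P x y) →
  length xs ≤ total h ys
length≤total h P {xs} {ys} uxs inj pick = ℕ.≤-trans (length≤ _ rep) (total-mono h (unique uxs rep) ⊆ys)
  where
  Rep = λ x → ∃[ y ] y ∈ˡ ys × 1 ≤ h y × P x y
  rep : All Rep xs
  rep = All.tabulate pick
  reps : ∀ {xs} → All Rep xs → List _
  reps []       = []
  reps (r ∷ rs) = proj₁ r ∷ reps rs
  length≤ : ∀ xs (rs : All Rep xs) → length xs ≤ total h (reps rs)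
  length≤ _ []       = z≤n
  length≤ _ ((_ , _ , 1≤ , _) ∷ rs) = ℕ.+-mono-≤ 1≤ (length≤ _ rs)
  ∈reps : ∀ {xs y} (rs : All Rep xs) → y ∈ˡ reps rs → y ∈ˡ ys × ∃[ x ] x ∈ˡ xs × P x y
  ∈reps ((_ , y∈ , _ , p) ∷ rs) (here refl) = y∈ , _ , here refl , p
  ∈reps (r ∷ rs) (there y∈) with ∈reps rs y∈
  ... | y∈ys , x , x∈ , p = y∈ys , x , there x∈ , p
  unique : ∀ {xs} → Unique xs → (rs : All Rep xs) → Unique (reps rs)
  unique _          []       = []
  unique (x∉ ∷ uxs) ((y , _ , _ , p) ∷ rs) = All.tabulate fresh ∷ unique uxs rs
    where
    fresh : ∀ {z} → z ∈ˡ reps rs → y ≢ z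
    fresh z∈ refl with ∈reps rs z∈
    ... | _ , x′ , x′∈ , p′ = inj (All.lookup x∉ x′∈) p p′
  ⊆ys : reps rep ⊆ ys
  ⊆ys y∈ = proj₁ (∈reps rep y∈)

-- Submodular functions of vertex sets

-- Boolean functions, so that unions and intersections compute pointwise and inequalities between
-- cuts reduce to truth tables.
Region : ℕ → Set
Region n = Fin n → Bool

infixr 7 _∩ʳ_
infixr 6 _∪ʳ_
_∪ʳ_ _∩ʳ_ : Region n → Region n → Region n
(Y ∪ʳ Z) v = Y v ∨ Z v
(Y ∩ʳ Z) v = Y v ∧ Z v

Extensional : (Region n → ℕ) → Set
Extensional f = ∀ {Y Z} → (∀ v → Y v ≡ Z v) → f Y ≡ f Z

record Submodular (f : Region n → ℕ) : Set where
  field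
    ext : Extensional f
    sub : ∀ Y Z → f (Y ∪ʳ Z) + f (Y ∩ʳ Z) ≤ f Y + f Z
open Submodular public

record Modular (f : Region n → ℕ) : Set where
  field
    ext : Extensional f
    mod : ∀ Y Z → f (Y ∪ʳ Z) + f (Y ∩ʳ Z) ≡ f Y + f Z

interchange : ∀ a b c d → (a + b) + (c + d) ≡ (a + c) + (b + d)
interchange = solve-∀

0-submodular : Submodular {n} (const 0)
0-submodular .ext _ = refl
0-submodular .sub _ _ = z≤n

+-submodular : {f g : Region n → ℕ} → Submodular f → Submodular g → Submodular (λ Z → f Z + g Z)
+-submodular sf sg .ext eq = cong₂ _+_ (sf .ext eq) (sg .ext eq)
+-submodular {f = f} {g} sf sg .sub Y Z = subst₂ _≤_
  (interchange (f (Y ∪ʳ Z)) _ _ _) (interchange (f Y) _ _ _)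
  (ℕ.+-mono-≤ (sf .sub Y Z) (sg .sub Y Z))

total-submodular : (h : Region n → A → ℕ) → (∀ x → Submodular (λ Z → h Z x)) →
  ∀ xs → Submodular (λ Z → total (h Z) xs)
total-submodular h sh []       = 0-submodular
total-submodular h sh (x ∷ xs) = +-submodular (sh x) (total-submodular h sh xs)

module _ {f g : Region n → ℕ} (ef : Extensional f) (eg : Extensional g) (c : Fin n) where

  -- Only finitely many vertex sets have to be searched; extensionality transfers the result from
  -- `Subset` to all Boolean functions.
  compare : (∀ Z → Z c ≡ false → f Z ≤ g Z) ⊎ (∃[ Z ] Z c ≡ false × g Z < f Z)
  compare with Subset.anySubset? {P = λ S → Vec.lookup S c ≡ false × g (Vec.lookup S) < f (Vec.lookup S)}
                 (λ S → (_ Bool.≟ _) ×-dec (_ ℕ.<? _))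
  ... | yes (S , p) = inj₂ (Vec.lookup S , p)
  ... | no ¬p = inj₁ λ Z c∉Z → ℕ.≮⇒≥ λ lt →
    let look = λ v → sym (Vec.lookup∘tabulate Z v) in
    ¬p (Vec.tabulate Z , trans (sym (look c)) c∉Z , subst₂ _<_ (eg look) (ef look) lt)

-- Menger's theorem

-- Tokens start at the vertices `s i`. If `c` lies outside `Z`, this is the number of walks that
-- have to leave `Z` on the way to `c`.
demand : (Fin k → Fin n) → Region n → ℕ
demand {zero}  s Z = 0
demand {suc k} s Z = ⟦ Z (s zero) ⟧ + demand (s ∘ suc) Z

⟦⟧-modular : ∀ a b → ⟦ a ∨ b ⟧ + ⟦ a ∧ b ⟧ ≡ ⟦ a ⟧ + ⟦ b ⟧
⟦⟧-modular true  true  = refl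
⟦⟧-modular true  false = refl
⟦⟧-modular false true  = refl
⟦⟧-modular false false = refl

demand-modular : (s : Fin k → Fin n) → Modular (demand s)
demand-modular {zero}  s .Modular.ext _   = refl
demand-modular {zero}  s .Modular.mod _ _ = refl
demand-modular {suc k} s .Modular.ext eq  =
  cong₂ _+_ (cong ⟦_⟧ (eq (s zero))) (demand-modular (s ∘ suc) .Modular.ext eq)
demand-modular {suc k} s .Modular.mod Y Z = trans
  (interchange ⟦ Y (s zero) ∨ Z (s zero) ⟧ _ _ _)
  (trans (cong₂ _+_ (⟦⟧-modular (Y (s zero)) _) (demand-modular (s ∘ suc) .Modular.mod Y Z))
         (interchange ⟦ Y (s zero) ⟧ _ _ _))

demand≤ : (s : Fin k → Fin n) (Z : Region n) → demand s Z ≤ k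
demand≤ {zero}  s Z = z≤n
demand≤ {suc k} s Z = ℕ.+-mono-≤ (⟦⟧≤1 _) (demand≤ (s ∘ suc) Z)

demand≡0 : (s : Fin k → Fin n) (Z : Region n) → (∀ i → Z (s i) ≡ false) → demand s Z ≡ 0
demand≡0 {zero}  s Z s∉Z = refl
demand≡0 {suc k} s Z s∉Z rewrite s∉Z zero = demand≡0 (s ∘ suc) Z (s∉Z ∘ suc)

∀? : {P : Bool → Set} → (∀ b → Dec (P b)) → Dec (∀ b → P b)
∀? P? with P? true | P? false
... | yes t | yes f = yes λ { true → t ; false → f }
... | no ¬t | _     = no λ all → ¬t (all true)
... | _     | no ¬f = no λ all → ¬f (all false)

module _ {G : Graph} where
  open Graph G hiding (V; E)

  -- The start is omitted: a walk may begin in the forbidden region, though it may not enter it.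
  vertsAfter : ∀ {u v} → Walk G u v → List (V G)
  vertsAfter nil              = []
  vertsAfter (step {w = w} e j p) = w ∷ vertsAfter p

  record Arc : Set where
    constructor arc
    field
      edge  : E G
      {src} : V G
      {tgt} : V G
      joins : Joins edge src tgt
  open Arc

  forward backward : E G → Arc
  forward  e = arc e (inj₁ refl)
  backward e = arc e (inj₂ refl)

  -- W is the set of vertices that may not be entered.
  module Menger (W : Region #V) (c : V G) where

    leaves : Region #V → Arc → Bool
    leaves Z a = Z (src a) ∧ not (Z (tgt a)) ∧ not (W (tgt a))

    -- The capacity of an unoriented edge: at most one of its two directions leaves `Z`.
    crossing : Region #V → E G → ℕ
    crossing Z e = ⟦ leaves Z (forward e) ⟧ + ⟦ leaves Z (backward e) ⟧

    leaves-submodular : ∀ a → Submodular (λ Z → ⟦ leaves Z a ⟧)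
    leaves-submodular a .ext eq = cong ⟦_⟧ (cong₂ (λ p q → p ∧ not q ∧ _) (eq _) (eq _))
    leaves-submodular a .sub Y Z = table (Y (src a)) (Y (tgt a)) (Z (src a)) (Z (tgt a)) (W (tgt a))
      where
      table : ∀ yu yw zu zw b →
        ⟦ (yu ∨ zu) ∧ not (yw ∨ zw) ∧ not b ⟧ + ⟦ (yu ∧ zu) ∧ not (yw ∧ zw) ∧ not b ⟧
        ≤ ⟦ yu ∧ not yw ∧ not b ⟧ + ⟦ zu ∧ not zw ∧ not b ⟧
      table = toWitness {a? = ∀? λ yu → ∀? λ yw → ∀? λ zu → ∀? λ zw → ∀? λ b → _ ℕ.≤? _} _

    Bounded : (f g : Region #V → ℕ) → Set
    Bounded f g = ∀ Z → Z c ≡ false → f Z ≤ g Z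

    out : List Arc → Region #V → ℕ
    out O Z = total (λ a → ⟦ leaves Z a ⟧) O

    out-submodular : ∀ O → Submodular (out O)
    out-submodular = total-submodular (λ Z a → ⟦ leaves Z a ⟧) leaves-submodular

    boundary : List (E G) → Region #V → ℕ
    boundary U Z = total (crossing Z) U

    boundary-submodular : ∀ U → Submodular (boundary U)
    boundary-submodular = total-submodular crossing
      λ e → +-submodular (leaves-submodular (forward e)) (leaves-submodular (backward e))

    -- If both choices failed, the two violated sets Y ∋ u and Z ∋ w, where e = uw,
    -- could be uncrossed: e leaves neither Y ∪ Z nor Y ∩ Z.
    orient-edge : {d f : Region #V → ℕ} → Modular d → Submodular f → ∀ e →
      Bounded d (λ Z → f Z + crossing Z e) →
      Bounded d (λ Z → f Z + ⟦ leaves Z (forward e) ⟧) ⊎ Bounded d (λ Z → f Z + ⟦ leaves Z (backward e) ⟧)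
    orient-edge {d} {f} md sf e bound
      with compare (md .Modular.ext) (+-submodular sf (leaves-submodular (forward e)) .ext) c
         | compare (md .Modular.ext) (+-submodular sf (leaves-submodular (backward e)) .ext) c
    ... | inj₁ ok | _ = inj₁ ok
    ... | inj₂ _  | inj₁ ok = inj₂ ok
    ... | inj₂ (Y , c∉Y , vioY) | inj₂ (Z , c∉Z , vioZ) =
      contradiction (begin-strict
        d Y + d Z                                  ≡⟨ md .Modular.mod Y Z ⟨
        d (Y ∪ʳ Z) + d (Y ∩ʳ Z)
          ≤⟨ ℕ.+-mono-≤ (bound _ (cong₂ _∨_ c∉Y c∉Z)) (bound _ (cong₂ _∧_ c∉Y c∉Z)) ⟩
        (f (Y ∪ʳ Z) + crossing (Y ∪ʳ Z) e) + (f (Y ∩ʳ Z) + crossing (Y ∩ʳ Z) e)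
          ≡⟨ interchange (f (Y ∪ʳ Z)) _ _ _ ⟩
        (f (Y ∪ʳ Z) + f (Y ∩ʳ Z)) + (crossing (Y ∪ʳ Z) e + crossing (Y ∩ʳ Z) e)
          ≤⟨ ℕ.+-mono-≤ (sf .sub Y Z) (ℕ.≤-reflexive uncrossed) ⟩
        (f Y + f Z) + 0                            ≡⟨ ℕ.+-identityʳ _ ⟩
        f Y + f Z                                  ≤⟨ ℕ.+-mono-≤ (ℕ.m≤m+n (f Y) _) (ℕ.m≤m+n (f Z) _) ⟩
        (f Y + ⟦ leaves Y (forward e) ⟧) + (f Z + ⟦ leaves Z (backward e) ⟧)
          <⟨ ℕ.+-mono-< vioY vioZ ⟩
        d Y + d Z                                  ∎) (ℕ.<-irrefl refl)
      where
      open ≤-Reasoning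
      u w : V G
      u = proj₁ (ends e)
      w = proj₂ (ends e)
      -- The bound holds at `Y` when both directions of `e` count but fails with `forward e` alone,
      -- so `backward e` leaves `Y`; for `Z` the directions are exchanged.
      used : ∀ x a {d′} b → x + a < d′ → d′ ≤ x + (a + ⟦ b ⟧) → b ≡ true
      used x a true  _  _ = refl
      used x a false lt le = contradiction (subst (λ z → _ ≤ x + z) (ℕ.+-identityʳ a) le) (ℕ.<⇒≱ lt)
      table : ∀ yu yw zu zw bu bw → yw ∧ not yu ∧ not bu ≡ true → zu ∧ not zw ∧ not bw ≡ true →
        (⟦ (yu ∨ zu) ∧ not (yw ∨ zw) ∧ not bw ⟧ + ⟦ (yw ∨ zw) ∧ not (yu ∨ zu) ∧ not bu ⟧)
        + (⟦ (yu ∧ zu) ∧ not (yw ∧ zw) ∧ not bw ⟧ + ⟦ (yw ∧ zw) ∧ not (yu ∧ zu) ∧ not bu ⟧) ≡ 0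
      table = toWitness {a? = ∀? λ yu → ∀? λ yw → ∀? λ zu → ∀? λ zw → ∀? λ bu → ∀? λ bw →
        (_ Bool.≟ _) →-dec ((_ Bool.≟ _) →-dec (_ ℕ.≟ _))} _
      uncrossed : crossing (Y ∪ʳ Z) e + crossing (Y ∩ʳ Z) e ≡ 0
      uncrossed = table (Y u) (Y w) (Z u) (Z w) (W u) (W w)
        (used (f Y) _ (leaves Y (backward e)) vioY (bound Y c∉Y))
        (used (f Z) _ (leaves Z (forward e)) vioZ
          (subst (λ z → d Z ≤ f Z + z) (ℕ.+-comm ⟦ leaves Z (forward e) ⟧ _) (bound Z c∉Z)))

    -- Edges are oriented one at a time. Each chosen arc is absorbed into the submodular function
    -- `f`, so that `orient-edge` applies again.
    orient : {d f : Region #V → ℕ} → Modular d → Submodular f → ∀ U →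
      Bounded d (λ Z → f Z + boundary U Z) →
      ∃[ O ] map edge O ≡ U × Bounded d (λ Z → f Z + out O Z)
    orient md sf [] bound = [] , refl , bound
    orient {d} {f} md sf (e ∷ U) bound =
      Sum.[ extend (forward e) refl , extend (backward e) refl ]
        (orient-edge md (+-submodular sf (boundary-submodular U)) e
          λ Z c∉Z → subst (d Z ≤_) (shuffle (f Z) _ _) (bound Z c∉Z))
      where
      shuffle : ∀ a b c → a + (b + c) ≡ (a + c) + b
      shuffle = solve-∀
      shuffle′ : ∀ a b c → (a + b) + c ≡ (a + c) + b
      shuffle′ = solve-∀
      extend : ∀ a → edge a ≡ e → Bounded d (λ Z → (f Z + boundary U Z) + ⟦ leaves Z a ⟧) →
        ∃[ O ] map edge O ≡ e ∷ U × Bounded d (λ Z → f Z + out O Z)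
      extend a refl bound′
        with orient md (+-submodular sf (leaves-submodular a)) U
               (λ Z c∉Z → subst (d Z ≤_) (shuffle′ (f Z) _ _) (bound′ Z c∉Z))
      ... | O , refl , b = a ∷ O , refl , λ Z c∉Z → subst (d Z ≤_) (ℕ.+-assoc (f Z) _ _) (b Z c∉Z)

total-≤ : (h h′ : A → ℕ) (xs : List A) → (∀ {x} → x ∈ˡ xs → h x ≤ h′ x) → total h xs ≤ total h′ xs
total-≤ h h′ []       le = z≤n
total-≤ h h′ (x ∷ xs) le = ℕ.+-mono-≤ (le (here refl)) (total-≤ h h′ xs (le ∘ there))

⟦⟧-mono : ∀ {a b} → (a ≡ true → b ≡ true) → ⟦ a ⟧ ≤ ⟦ b ⟧
⟦⟧-mono {false} imp = z≤n
⟦⟧-mono {true}  imp rewrite imp refl = s≤s z≤n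

demand-mono : (s : Fin k → Fin n) {Y Z : Region n} → (∀ v → Y v ≡ true → Z v ≡ true) →
  demand s Y ≤ demand s Z
demand-mono {zero}  s imp = z≤n
demand-mono {suc k} s imp = ℕ.+-mono-≤ (⟦⟧-mono (imp (s zero))) (demand-mono (s ∘ suc) imp)

module _ {G : Graph} (W : Region (Graph.#V G)) (c : V G) where
  open Graph G hiding (V; E)
  open Arc
  open Menger {G} W c

  -- Restricting the walks to `es` records which edges are still available: an arc deleted after use
  -- cannot recur in walks built from the remaining arcs.
  record Routing (s : Fin k → V G) (es : List (E G)) : Set where
    field
      walks    : ∀ i → Walk G (s i) c
      avoid    : ∀ i {v} → v ∈ˡ vertsAfter (walks i) → W v ≡ false
      edges⊆   : ∀ i → walkEdges (walks i) ⊆ es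
      disjoint : ∀ {i j} → i ≢ j → Disjoint (walkEdges (walks i)) (walkEdges (walks j))
  open Routing

  cons : {s : Fin (suc k) → V G} {es : List (E G)} (p : Walk G (s zero) c) →
    (∀ {v} → v ∈ˡ vertsAfter p → W v ≡ false) → walkEdges p ⊆ es →
    (r : Routing (s ∘ suc) es) → (∀ i → Disjoint (walkEdges p) (walkEdges (r .walks i))) →
    Routing s es
  cons p av p⊆ r dis .walks zero = p
  cons p av p⊆ r dis .walks (suc i) = r .walks i
  cons p av p⊆ r dis .avoid zero = av
  cons p av p⊆ r dis .avoid (suc i) = r .avoid i
  cons p av p⊆ r dis .edges⊆ zero = p⊆
  cons p av p⊆ r dis .edges⊆ (suc i) = r .edges⊆ i
  cons p av p⊆ r dis .disjoint {zero} {zero} i≢j = contradiction refl i≢j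
  cons p av p⊆ r dis .disjoint {zero} {suc j} i≢j = dis j
  cons p av p⊆ r dis .disjoint {suc i} {zero} i≢j (e∈ , e∈′) = dis i (e∈′ , e∈)
  cons p av p⊆ r dis .disjoint {suc i} {suc j} i≢j = r .disjoint (i≢j ∘ cong suc)

  -- Tokens on v ≢ c and on s travel to c.  If the token on v could use none of the arcs out of v,
  -- each would enter a tight set; the union of these sets, extended by v, would violate the bound.
  module Move {v : V G} (v≢c : v ≢ c) (s : Fin k → V G) (O : List (Arc {G}))
              (bound : Bounded (demand (v ∷ᶠ s)) (out O)) where

    record Movable : Set where
      field
        {w}   : V G
        {e}   : E G
        j     : Joins e v w
        {before after} : List (Arc {G})
        split : O ≡ before ++ arc e j ∷ after
        enter : W w ≡ false
        bound′ : Bounded (demand (w ∷ᶠ s)) (out (before ++ after))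

    -- As `v` is not in `Z`, `bound` gives the reverse inequality, so `demand s Z` and `out O Z` are
    -- equal.
    record Tight (Z : Region #V) : Set where
      field
        c∉    : Z c ≡ false
        v∉    : Z v ≡ false
        tight : out O Z ≤ demand s Z
    open Tight

    ∅-tight : Tight (const false)
    ∅-tight .c∉ = refl
    ∅-tight .v∉ = refl
    ∅-tight .tight = ℕ.≤-trans (ℕ.≤-reflexive (out-∅ O)) z≤n
      where
      out-∅ : ∀ O → out O (const false) ≡ 0
      out-∅ []      = refl
      out-∅ (_ ∷ O) = out-∅ O

    -- The usual uncrossing: `out O` is submodular, `demand s` is modular, and `bound` at the
    -- intersection leaves no slack for the union.
    ∪-tight : ∀ {Y Z} → Tight Y → Tight Z → Tight (Y ∪ʳ Z)
    ∪-tight tY tZ .c∉ = cong₂ _∨_ (tY .c∉) (tZ .c∉)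
    ∪-tight tY tZ .v∉ = cong₂ _∨_ (tY .v∉) (tZ .v∉)
    ∪-tight {Y} {Z} tY tZ .tight = ℕ.+-cancelʳ-≤ (out O (Y ∩ʳ Z)) _ _ (begin
      out O (Y ∪ʳ Z) + out O (Y ∩ʳ Z)        ≤⟨ out-submodular O .sub Y Z ⟩
      out O Y + out O Z                      ≤⟨ ℕ.+-mono-≤ (tY .tight) (tZ .tight) ⟩
      demand s Y + demand s Z                ≡⟨ demand-modular s .Modular.mod Y Z ⟨
      demand s (Y ∪ʳ Z) + demand s (Y ∩ʳ Z)
        ≤⟨ ℕ.+-monoʳ-≤ (demand s (Y ∪ʳ Z))
             (ℕ.≤-trans (ℕ.m≤n+m _ ⟦ Y v ∧ Z v ⟧) (bound (Y ∩ʳ Z) (cong₂ _∧_ (tY .c∉) (tZ .c∉)))) ⟩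
      demand s (Y ∪ʳ Z) + out O (Y ∩ʳ Z)     ∎)
      where open ≤-Reasoning

    -- Deleting the arc lowers `out O Z` by one only if the arc leaves `Z`, and moving the token
    -- changes the demand only if `Z` separates `v` from `w`. Comparing the four cases, a violation
    -- needs a tight set that contains `w` but not `v`.
    violated⇒tight : ∀ {w e} (j : Joins e v w) {as bs} → O ≡ as ++ arc e j ∷ bs → ∀ Z → Z c ≡ false →
      out (as ++ bs) Z < demand (w ∷ᶠ s) Z → Tight Z × Z w ≡ true
    violated⇒tight {w} j {as} {bs} refl Z c∉Z vio =
      let v∉Z , w∈Z , le = uncovered (Z v) (Z w) (subst (_ ≤_) out≡ (bound Z c∉Z)) vio
      in record { c∉ = c∉Z ; v∉ = v∉Z ; tight = subst (_≤ _) (sym out≡) le } , w∈Z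
      where
      swap : ∀ x y z → x + (y + z) ≡ y + (x + z)
      swap = solve-∀
      out≡ : out (as ++ arc _ j ∷ bs) Z ≡ ⟦ leaves Z (arc _ j) ⟧ + out (as ++ bs) Z
      out≡ = trans (total-++ _ as (arc _ j ∷ bs)) (trans (swap (out as Z) ⟦ leaves Z (arc _ j) ⟧ (out bs Z))
               (cong (⟦ leaves Z (arc _ j) ⟧ +_) (sym (total-++ _ as bs))))
      uncovered : ∀ zv zw {b d o} → ⟦ zv ⟧ + d ≤ ⟦ zv ∧ not zw ∧ b ⟧ + o → o < ⟦ zw ⟧ + d →
        zv ≡ false × zw ≡ true × ⟦ zv ∧ not zw ∧ b ⟧ + o ≤ d
      uncovered false false le lt = contradiction le (ℕ.<⇒≱ lt)
      uncovered true  false le lt =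
        contradiction (ℕ.≤-trans le (ℕ.+-monoˡ-≤ _ (⟦⟧≤1 _))) (ℕ.<⇒≱ (s≤s lt))
      uncovered true  true  le lt = contradiction le (ℕ.<⇒≱ lt)
      uncovered false true  le lt = refl , refl , ℕ.≤-pred lt

    Covers : Region #V → List (Arc {G}) → Set
    Covers Z L = ∀ {a} → a ∈ˡ L → src a ≡ v → W (tgt a) ≡ false → tgt a ≢ v → Z (tgt a) ≡ true

    scan : ∀ L → L ⊆ O → Movable ⊎ (∃[ Z ] Tight Z × Covers Z L)
    scan [] L⊆ = inj₂ (const false , ∅-tight , λ ())
    scan (a@(arc e {x} {w} j) ∷ L) L⊆ with scan L (L⊆ ∘ there)
    ... | inj₁ m = inj₁ m
    ... | inj₂ (Y , tY , covY) with x Fin.≟ v | W w in ew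
    ...   | no x≢v | _ = inj₂ (Y , tY , λ { (here refl) x≡v → contradiction x≡v x≢v ; (there a∈) → covY a∈ })
    ...   | yes _ | true = inj₂ (Y , tY , λ { (here refl) _ w∉W → contradiction (trans (sym ew) w∉W) λ () ; (there a∈) → covY a∈ })
    ...   | yes refl | false with ∈-∃++ (L⊆ (here refl))
    ...     | as , bs , eq with compare (demand-modular (w ∷ᶠ s) .Modular.ext) (out-submodular (as ++ bs) .ext) c
    ...       | inj₁ ok = inj₁ record { j = j ; split = eq ; enter = ew ; bound′ = ok }
    ...       | inj₂ (Z , c∉Z , vio) with violated⇒tight j eq Z c∉Z vio
    ...         | tZ , w∈Z = inj₂ (Y ∪ʳ Z , ∪-tight tY tZ , λ
      { (here refl) _ _ _ → trans (cong (_ ∨_) w∈Z) (Bool.∨-zeroʳ _)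
      ; (there a∈) p q r → cong (_∨ _) (covY a∈ p q r) })

    movable : Movable
    movable with scan O id
    ... | inj₁ m = m
    ... | inj₂ (U , tU , cov) = contradiction (begin-strict
        out O U                            ≤⟨ tU .tight ⟩
        demand s U                         ≤⟨ demand-mono s (λ z z∈ → cong (_∨ _) z∈) ⟩
        demand s Y                         <⟨ ℕ.n<1+n _ ⟩
        suc (demand s Y)                   ≡⟨ cong (λ b → ⟦ b ⟧ + demand s Y) v∈Y ⟨
        demand (v ∷ᶠ s) Y                  ≤⟨ bound Y (cong₂ _∨_ (tU .c∉) (dec-false (c Fin.≟ v) (v≢c ∘ sym))) ⟩
        out O Y                            ≤⟨ total-≤ _ _ O (λ a∈ → ⟦⟧-mono (shrink a∈)) ⟩
        out O U                            ∎) (ℕ.<-irrefl refl)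
      where
      open ≤-Reasoning
      Y : Region #V
      Y z = U z ∨ does (z Fin.≟ v)
      v∈Y : Y v ≡ true
      v∈Y = trans (cong (U v ∨_) (dec-true (v Fin.≟ v) refl)) (Bool.∨-zeroʳ _)
      -- Adding `v` to `U` creates no new leaving arc: every arc of `O` from `v` to a permitted
      -- vertex other than `v` ends in `U`.
      shrink : ∀ {a} → a ∈ˡ O → leaves Y a ≡ true → leaves U a ≡ true
      shrink {a} a∈ lv with U (src a) | src a Fin.≟ v | U (tgt a) in eu | tgt a Fin.≟ v | W (tgt a) in ew
      ... | true  | _ | false | no _   | false = refl
      ... | false | yes p | false | no t≢v | false = trans (sym eu) (cov a∈ p ew t≢v)

  keep : ∀ (as : List (Arc {G})) {a bs} → map edge (as ++ bs) ⊆ map edge (as ++ a ∷ bs)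
  keep as f∈ with ∈-map⁻ (edge {G}) f∈
  ... | b , b∈ , refl with ∈-++⁻ as b∈
  ...   | inj₁ b∈as = ∈-map⁺ edge (∈-++⁺ˡ b∈as)
  ...   | inj₂ b∈bs = ∈-map⁺ edge (∈-++⁺ʳ as (there b∈bs))

  -- Each step removes either a token or an arc. A token already on `c` gets the trivial walk; any
  -- other moves along one arc, which is deleted, and `Unique` prevents its edge from being used
  -- again.
  route : ∀ ℓ O (s : Fin k → V G) → length O ≡ ℓ → Unique (map edge O) → Bounded (demand s) (out O) →
    Routing s (map edge O)
  route {zero} ℓ O s len uO bound = record { walks = λ () ; avoid = λ () ; edges⊆ = λ () ; disjoint = λ {} }
  route {suc k} ℓ O s len uO bound with s zero Fin.≟ c
  ... | yes s₀≡c = cons (subst (Walk G (s zero)) s₀≡c nil)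
      (λ v∈ → contradiction v∈ (nil-verts s₀≡c)) (λ e∈ → contradiction e∈ (nil-edges s₀≡c))
      (route ℓ O (s ∘ suc) len uO λ Z c∉Z → ℕ.≤-trans (ℕ.m≤n+m _ ⟦ Z (s zero) ⟧) (bound Z c∉Z))
      (λ { i (e∈ , _) → nil-edges s₀≡c e∈ })
    where
    nil-verts : ∀ {u w x} (eq : u ≡ w) → ¬ (x ∈ˡ vertsAfter (subst (Walk G u) eq nil))
    nil-verts refl ()
    nil-edges : ∀ {u w e} (eq : u ≡ w) → ¬ (e ∈ˡ walkEdges (subst (Walk G u) eq nil))
    nil-edges refl ()
  route {suc k} ℓ O s len uO bound | no s₀≢c with Move.movable s₀≢c (s ∘ suc) O bound
  route {suc k} zero _ s len uO bound | no _ | record { before = [] ; split = refl } = contradiction len λ ()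
  route {suc k} zero _ s len uO bound | no _ | record { before = _ ∷ _ ; split = refl } = contradiction len λ ()
  route {suc k} (suc ℓ) _ s len uO bound | no _
    | record { e = e ; j = j ; before = as ; after = bs ; split = refl ; enter = enter ; bound′ = bound′ }
    = cons (step e j (r .walks zero))
        (λ { (here refl) → enter ; (there v∈) → r .avoid zero v∈ })
        (λ { (here refl) → e∈ ; (there f∈) → rest⊆ (r .edges⊆ zero f∈) })
        (record { walks = r .walks ∘ suc ; avoid = r .avoid ∘ suc ; edges⊆ = λ i → rest⊆ ∘ r .edges⊆ (suc i)
                ; disjoint = λ i≢j → r .disjoint (i≢j ∘ Fin.suc-injective) })
        (λ { i (here refl , f∈) → fresh (r .edges⊆ (suc i) f∈)
           ; i (there f∈ , f∈′) → r .disjoint {zero} {suc i} (λ ()) (f∈ , f∈′) })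
    where
    rest⊆ : map edge (as ++ bs) ⊆ map edge (as ++ arc e j ∷ bs)
    rest⊆ = keep as
    e∈ : e ∈ˡ map edge (as ++ arc e j ∷ bs)
    e∈ = ∈-map⁺ edge (∈-++⁺ʳ as (here refl))
    drop-mid : ∀ (as : List (Arc {G})) {a bs} → Unique (map edge (as ++ a ∷ bs)) →
      Unique (map edge (as ++ bs)) × edge a ∉ˡ map edge (as ++ bs)
    drop-mid [] (a∉ ∷ u) = u , λ a∈ → All.lookup a∉ a∈ refl
    drop-mid (x ∷ as) {a} {bs} (x∉ ∷ u) with drop-mid as u
    ... | u′ , a∉ = All.tabulate (λ f∈ → All.lookup x∉ (keep as f∈)) ∷ u′ , λ
      { (here eq) → All.lookup x∉ (∈-map⁺ edge (∈-++⁺ʳ as (here refl))) (sym eq) ; (there a∈) → a∉ a∈ }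
    fresh : e ∉ˡ map edge (as ++ bs)
    fresh = proj₂ (drop-mid as uO)
    r : Routing (_ ∷ᶠ (s ∘ suc)) (map edge (as ++ bs))
    r = route ℓ (as ++ bs) _ (shorter as len) (proj₁ (drop-mid as uO)) bound′
      where
      shorter : ∀ as {a bs} → length (as ++ a ∷ bs) ≡ suc ℓ → length (as ++ bs) ≡ ℓ
      shorter as {a} {bs} eq = ℕ.suc-injective (trans (sym (List.length-++-sucʳ as a bs)) eq)

  menger : (s : Fin k → V G) → Bounded (demand s) (boundary (allFin #E)) → Routing s (allFin #E)
  menger s bound with orient {f = const 0} (demand-modular s) 0-submodular (allFin #E) bound
  ... | O , eq , b = subst (Routing s) eq
    (route _ O s refl (subst Unique (sym eq) (Unique.allFin⁺ #E)) b)

-- Walks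

module _ {G : Graph} where
  open Graph G hiding (V; E)

  joins-sym : ∀ {e u v} → Joins e u v → Joins e v u
  joins-sym = Sum.swap

  infixr 5 _++ʷ_
  _++ʷ_ : ∀ {u v w} → Walk G u v → Walk G v w → Walk G u w
  nil        ++ʷ q = q
  step e j p ++ʷ q = step e j (p ++ʷ q)

  reverse : ∀ {u v} → Walk G u v → Walk G v u
  reverse nil          = nil
  reverse (step e j p) = reverse p ++ʷ step e (joins-sym j) nil

  start∈ : ∀ {u v} (p : Walk G u v) → u ∈ˡ walkVertices p
  start∈ nil          = here refl
  start∈ (step _ _ _) = here refl

  end∈ : ∀ {u v} (p : Walk G u v) → v ∈ˡ walkVertices p
  end∈ nil          = here refl
  end∈ (step _ _ p) = there (end∈ p)

  ∈-vertsAfter : ∀ {u v x} (p : Walk G u v) → x ∈ˡ walkVertices p → x ≡ u ⊎ x ∈ˡ vertsAfter p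
  ∈-vertsAfter nil          (here eq)  = inj₁ eq
  ∈-vertsAfter (step _ _ p) (here eq)  = inj₁ eq
  ∈-vertsAfter (step _ _ p) (there x∈) with ∈-vertsAfter p x∈
  ... | inj₁ eq   = inj₂ (here eq)
  ... | inj₂ x∈p  = inj₂ (there x∈p)

  ++ʷ-edges : ∀ {u v w e} (p : Walk G u v) {q : Walk G v w} →
    e ∈ˡ walkEdges (p ++ʷ q) → e ∈ˡ walkEdges p ⊎ e ∈ˡ walkEdges q
  ++ʷ-edges nil          e∈         = inj₂ e∈
  ++ʷ-edges (step _ _ p) (here eq)  = inj₁ (here eq)
  ++ʷ-edges (step _ _ p) (there e∈) = Sum.map₁ there (++ʷ-edges p e∈)

  ++ʷ-vertices : ∀ {u v w x} (p : Walk G u v) {q : Walk G v w} →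
    x ∈ˡ walkVertices (p ++ʷ q) → x ∈ˡ walkVertices p ⊎ x ∈ˡ walkVertices q
  ++ʷ-vertices nil          x∈         = inj₂ x∈
  ++ʷ-vertices (step _ _ p) (here eq)  = inj₁ (here eq)
  ++ʷ-vertices (step _ _ p) (there x∈) = Sum.map₁ there (++ʷ-vertices p x∈)

  reverse-edges : ∀ {u v} (p : Walk G u v) → walkEdges (reverse p) ⊆ walkEdges p
  reverse-edges (step e j p) e∈ with ++ʷ-edges (reverse p) e∈
  ... | inj₁ e∈p         = there (reverse-edges p e∈p)
  ... | inj₂ (here refl) = here refl

  reverse-vertices : ∀ {u v} (p : Walk G u v) → walkVertices (reverse p) ⊆ walkVertices p
  reverse-vertices nil          x∈ = x∈
  reverse-vertices (step e j p) x∈ with ++ʷ-vertices (reverse p) x∈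
  ... | inj₁ x∈p                 = there (reverse-vertices p x∈p)
  ... | inj₂ (here refl)         = there (start∈ p)
  ... | inj₂ (there (here refl)) = here refl

  ends∈ : ∀ {u v e x} (p : Walk G u v) → e ∈ˡ walkEdges p → Incident e x → x ∈ˡ walkVertices p
  ends∈ (step e (inj₁ eq) p) (here refl) (inj₁ refl) = here (cong proj₁ eq)
  ends∈ (step e (inj₁ eq) p) (here refl) (inj₂ refl) rewrite cong proj₂ eq = there (start∈ p)
  ends∈ (step e (inj₂ eq) p) (here refl) (inj₁ refl) rewrite cong proj₁ eq = there (start∈ p)
  ends∈ (step e (inj₂ eq) p) (here refl) (inj₂ refl) = here (cong proj₂ eq)
  ends∈ (step e j p)         (there e∈)  inc         = there (ends∈ p e∈ inc)

  joins⇒incident : ∀ {e u v} → Joins e u v → Incident e u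
  joins⇒incident (inj₁ eq) = inj₁ (sym (cong proj₁ eq))
  joins⇒incident (inj₂ eq) = inj₂ (sym (cong proj₂ eq))

  record _≼_ {u v u′ v′} (q : Walk G u v) (p : Walk G u′ v′) : Set where
    constructor within
    field
      edges    : walkEdges q ⊆ walkEdges p
      vertices : walkVertices q ⊆ walkVertices p
  open _≼_ public

  ≼-step : ∀ {u v w u′ v′ e} {j : Joins e u w} {q : Walk G u′ v′} {p : Walk G w v} →
    q ≼ p → q ≼ step e j p
  ≼-step (within e⊆ v⊆) = within (there ∘ e⊆) (there ∘ v⊆)

  step-≼ : ∀ {u v w v′ e} {j : Joins e u w} {q : Walk G w v′} {p : Walk G w v} →
    q ≼ p → step e j q ≼ step e j p
  step-≼ (within e⊆ v⊆) = within (λ { (here eq) → here eq ; (there e∈) → there (e⊆ e∈) })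
                           (λ { (here eq) → here eq ; (there v∈) → there (v⊆ v∈) })

  ≼-refl : ∀ {u v} {p : Walk G u v} → p ≼ p
  ≼-refl = within id id

  ≼-trans : ∀ {u v u′ v′ u″ v″} {p : Walk G u v} {q : Walk G u′ v′} {r : Walk G u″ v″} →
    p ≼ q → q ≼ r → p ≼ r
  ≼-trans (within e v) (within e′ v′) = within (e′ ∘ e) (v′ ∘ v)

  reverse-≼ : ∀ {u v} (p : Walk G u v) → reverse p ≼ p
  reverse-≼ p = within (reverse-edges p) (reverse-vertices p)

  suffix : ∀ {u v x} (p : Walk G u v) → IsPath p → x ∈ˡ walkVertices p →
    ∃[ q ] IsPath {u = x} {v} q × q ≼ p
  suffix nil            path       (here refl) = nil , path , ≼-refl
  suffix p@(step _ _ _) path       (here refl) = p , path , ≼-refl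
  suffix (step _ _ p)   (_ ∷ path) (there x∈)  =
    let q , isPath , q≼p = suffix p path x∈ in q , isPath , ≼-step q≼p

  shorten : ∀ {u v} (p : Walk G u v) → ∃[ q ] IsPath {u = u} {v} q × q ≼ p
  shorten nil = nil , [] ∷ [] , ≼-refl
  shorten {u} (step e j p) with shorten p
  ... | q , isPath , q≼p with u ∈ˡ? walkVertices q
  ...   | no u∉ = step e j q , All.tabulate (λ x∈ → λ { refl → u∉ x∈ }) ∷ isPath , step-≼ q≼p
  ...   | yes u∈ with suffix q isPath u∈
  ...     | r , isPath′ , r≼q = r , isPath′ , ≼-step (≼-trans r≼q q≼p)

  record Exit (Z : Region #V) {u v} (p : Walk G u v) : Set where
    field
      {e}     : E G
      {x y}   : V G
      e∈      : e ∈ˡ walkEdges p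
      joins   : Joins e x y
      x∈Z     : Z x ≡ true
      y∉Z     : Z y ≡ false
      y∈      : y ∈ˡ walkVertices p

  exit : (Z : Region #V) → ∀ {u v} (p : Walk G u v) → Z u ≡ true → Z v ≡ false → Exit Z p
  exit Z nil u∈ v∉ = contradiction (trans (sym u∈) v∉) λ ()
  exit Z (step {w = w} e j p) u∈ v∉ with Z w in eq
  ... | false = record { e∈ = here refl ; joins = j ; x∈Z = u∈ ; y∉Z = eq ; y∈ = there (start∈ p) }
  ... | true = record { e∈ = there X.e∈ ; joins = X.joins ; x∈Z = X.x∈Z ; y∉Z = X.y∉Z ; y∈ = there X.y∈ }
    where module X = Exit (exit Z p eq v∉)

  module _ {P : V G → Set} (P? : ∀ v → Dec (P v)) where

    afterLast : ∀ {u v} (p : Walk G u v) → P u → ¬ P v →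
      ∃[ b ] Σ[ q ∈ Walk G b v ] P b × q ≼ p × (∀ {x} → x ∈ˡ walkVertices q → P x → x ≡ b)
    afterLast p Pu ¬Pv with go p
      where
      go : ∀ {u v} (p : Walk G u v) → (∀ {x} → x ∈ˡ walkVertices p → ¬ P x) ⊎
        (∃[ b ] Σ[ q ∈ Walk G b v ] P b × q ≼ p × (∀ {x} → x ∈ˡ walkVertices q → P x → x ≡ b))
      go {u} nil with P? u
      ... | yes Pu = inj₂ (_ , nil , Pu , ≼-refl , λ { (here eq) _ → eq })
      ... | no ¬Pu = inj₁ λ { (here refl) → ¬Pu }
      go {u} (step e j p) with go p | P? u
      ... | inj₂ (b , q , Pb , q≼p , last) | _ = inj₂ (b , q , Pb , ≼-step q≼p , last)
      ... | inj₁ none | no ¬Pu = inj₁ λ { (here refl) → ¬Pu ; (there x∈) → none x∈ }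
      ... | inj₁ none | yes Pu = inj₂ (u , step e j p , Pu , ≼-refl ,
        λ { (here eq) _ → eq ; (there x∈) Px → contradiction Px (none x∈) })
    ... | inj₁ none = contradiction Pu (none (start∈ p))
    ... | inj₂ found = found

    untilFirst : ∀ {u v} (p : Walk G u v) → P v →
      ∃[ x ] Σ[ q ∈ Walk G u x ] P x × q ≼ p × (∀ {y} → y ∈ˡ walkVertices q → P y → y ≡ x)
    untilFirst nil Pv = _ , nil , Pv , ≼-refl , λ { (here eq) _ → eq }
    untilFirst {u} (step e j p) Pv with P? u
    ... | yes Pu = u , nil , Pu , within (λ ()) (λ { (here eq) → here eq }) , λ { (here eq) _ → eq }
    ... | no ¬Pu with untilFirst p Pv
    ...   | x , q , Px , q≼p , first = x , step e j q , Px , step-≼ q≼p ,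
      λ { (here refl) Py → contradiction Py ¬Pu ; (there y∈) Py → first y∈ Py }

  -- Leave `t` by the first edge of `p` and return along the rest of `p` and the reverse of `q`,
  -- shortened to a path. The first edge does not recur: the path `p` does not come back to `t`, and
  -- `q` shares no edge with `p`.
  cycle : ∀ {t u u′ c} → u ≡ t → u′ ≡ t → t ≢ c → (p : Walk G u c) (q : Walk G u′ c) → IsPath p → Disjoint (walkEdges p) (walkEdges q) →
    Σ[ C ∈ CycleThrough {G} t ] (∀ {e} → e ∈ˡ CycleThrough.cycleEdges {G} C → e ∈ˡ walkEdges p ⊎ e ∈ˡ walkEdges q)
  cycle refl refl t≢c nil q _ _ = contradiction refl t≢c
  cycle refl refl t≢c (step e j p) q (t∉p ∷ _) dis with shorten (p ++ʷ reverse q)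
  ... | back , isPath , within e⊆ _ = record
      { e = e ; joins = j ; back = back ; isPath = isPath
      ; notAgain = λ e∈ → Sum.[ (λ e∈p → All.lookup t∉p (ends∈ {e = e} p e∈p (joins⇒incident j)) refl)
                              , (λ e∈q → dis (here refl , reverse-edges q e∈q)) ] (++ʷ-edges p (e⊆ e∈)) }
    , λ { (here eq) → inj₁ (here eq)
        ; (there e∈) → Sum.map there (reverse-edges q) (++ʷ-edges p (e⊆ e∈)) }

-- Lower bounds for cuts from edge-disjoint walks

module _ {G : Graph} (W : Region (Graph.#V G)) (c : V G) where
  open Graph G hiding (V; E)
  open Menger {G} W c

  exit⇒crossing : ∀ {Z e x y} → Joins e x y → Z x ≡ true → Z y ≡ false → W y ≡ false → 1 ≤ crossing Z e
  exit⇒crossing {Z} {e} (inj₁ eq) x∈ y∉ w rewrite eq | x∈ | y∉ | w = s≤s z≤n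
  exit⇒crossing {Z} {e} (inj₂ eq) x∈ y∉ w rewrite eq | x∈ | y∉ | w = s≤s z≤n

  -- `P x e` will mean that `e` lies on the walk of `x`. Edge-disjointness then says that no `e`
  -- belongs to two walks, and each walk contributes an edge of its own to the cut.
  length≤boundary : ∀ {Z} (P : A → E G → Set) {xs : List A} → Unique xs →
    (∀ {x x′ e} → x ≢ x′ → P x e → ¬ P x′ e) →
    (∀ {x} → x ∈ˡ xs → ∃[ u ] ∃[ v ] Σ[ p ∈ Walk G u v ] Σ[ ex ∈ Exit Z p ]
       W (Exit.y ex) ≡ false × P x (Exit.e ex)) →
    length xs ≤ boundary (allFin #E) Z
  length≤boundary {Z = Z} P uxs inj pick = length≤total (crossing Z) P uxs inj λ x∈ →
    let _ , _ , p , ex , w , Pe = pick x∈ in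
    Exit.e ex , ∈-allFin _ , exit⇒crossing {Z} (Exit.joins ex) (Exit.x∈Z ex) (Exit.y∉Z ex) w , Pe

-- Trees with many marked nodes

AllPairs-++⁻ : {R : Rel A 0ℓ} (xs : List A) {ys : List A} → AllPairs R (xs ++ ys) →
  AllPairs R xs × AllPairs R ys × (∀ {x y} → x ∈ˡ xs → y ∈ˡ ys → R x y)
AllPairs-++⁻ []       u       = [] , u , λ ()
AllPairs-++⁻ (x ∷ xs) (r ∷ u) =
  let uxs , uys , across = AllPairs-++⁻ xs u in
  All.tabulate (All.lookup r ∘ ∈-++⁺ˡ) ∷ uxs , uys ,
  λ { (here refl) y∈ → All.lookup r (∈-++⁺ʳ xs y∈) ; (there x∈) y∈ → across x∈ y∈ }

module Trees {A : Set} (R : Rel A 0ℓ) (R-sym : ∀ {x y} → R x y → R y x) where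

  infixl 5 _⊳_
  -- In s ⊳ t the root of t becomes a child of the root of s.
  data Tree : A → Set where
    leaf : ∀ r → Tree r
    _⊳_  : ∀ {r c} → Tree r → R r c × Tree c → Tree r

  nodes : ∀ {r} → Tree r → List A
  nodes (leaf r)      = r ∷ []
  nodes (s ⊳ (_ , t)) = nodes s ++ nodes t

  root∈ : ∀ {r} (t : Tree r) → r ∈ˡ nodes t
  root∈ (leaf r) = here refl
  root∈ (s ⊳ _)  = ∈-++⁺ˡ (root∈ s)

  Step : (A → Set) → Rel A 0ℓ
  Step P x y = R x y × P y

  -- The start is exempt from `P`: a path that avoids the chosen nodes may begin at one of them.
  Reach : (A → Set) → Rel A 0ℓ
  Reach P = Star (Step P)

  reach-mono : ∀ {P Q x y} → (∀ {z} → P z → Q z) → Reach P x y → Reach Q x y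
  reach-mono imp = Star.map λ (r , p) → r , imp p

  Proper : ∀ {r} → Tree r → Set
  Proper t = Unique (nodes t)

  proper-⊳ : ∀ {r c} (s : Tree r) (t : Tree c) → Unique (nodes s ++ nodes t) →
    Proper s × Proper t × Disjoint (nodes s) (nodes t)
  proper-⊳ s t u = let us , ut , ne = AllPairs-++⁻ (nodes s) u in us , ut , λ (x∈ , x∈′) → ne x∈ x∈′ refl

  from-root : ∀ {r y} (t : Tree r) → Proper t → y ∈ˡ nodes t →
    Reach (λ z → z ∈ˡ nodes t × z ≢ r) r y
  from-root (leaf r) _ (here refl) = ε
  from-root {r} (s ⊳ (e , t)) u y∈ with proper-⊳ s t u | ∈-++⁻ (nodes s) y∈
  ... | us , _ , _   | inj₁ y∈s = reach-mono (λ (z∈ , z≢) → ∈-++⁺ˡ z∈ , z≢) (from-root s us y∈s)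
  ... | us , ut , dis | inj₂ y∈t =
    (e , in-t (root∈ t)) ◅ reach-mono (λ (z∈ , _) → in-t z∈) (from-root t ut y∈t)
    where
    in-t : ∀ {z} → z ∈ˡ nodes t → z ∈ˡ nodes s ++ nodes t × z ≢ r
    in-t z∈ = ∈-++⁺ʳ (nodes s) z∈ , λ { refl → dis (root∈ s , z∈) }

  module Marked {μ : A → Set} (μ? : ∀ v → Dec (μ v)) (D : ℕ) where

    marked : ∀ {r} → Tree r → List A
    marked t = filter μ? (nodes t)

    #_ : ∀ {r} → Tree r → ℕ
    # t = length (marked t)

    Light : ∀ {r} → Tree r → Set
    Light (leaf r)      = ⊤
    Light (s ⊳ (_ , t)) = Light s × # t < D

    record Split {r} (t : Tree r) : Set where
      field
        {c}   : A
        heavy : Tree c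
        rest  : Tree r
        light : Light heavy
        D≤    : D ≤ # heavy
        perm  : nodes t ↭ nodes heavy ++ nodes rest

    -- If `t` is not light, descend into a child subtree with at least `D` marked nodes as long as
    -- there is one; the subtree where this stops is light and can be cut off.
    split : ∀ {r} (t : Tree r) → Light t ⊎ Split t
    split (leaf r) = inj₁ _
    split (s ⊳ (e , t)) with D ℕ.≤? # t
    ... | no D≰ with split s
    ...   | inj₁ light = inj₁ (light , ℕ.≰⇒> D≰)
    ...   | inj₂ h = inj₂ record
      { Split h ; rest = Split.rest h ⊳ (e , t)
      ; perm = ↭-trans (++⁺ʳ (nodes t) (Split.perm h))
                 (↭-reflexive (List.++-assoc (nodes (Split.heavy h)) _ _)) }
    split (s ⊳ (e , t)) | yes D≤ with split t
    ...   | inj₁ light = inj₂ record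
      { heavy = t ; rest = s ; light = light ; D≤ = D≤ ; perm = ++-comm (nodes s) (nodes t) }
    ...   | inj₂ h = inj₂ record
      { Split h ; rest = s ⊳ (e , Split.rest h)
      ; perm = ↭-trans (++⁺ˡ (nodes s) (Split.perm h)) (shifts (nodes s) (nodes (Split.heavy h))) }

    record Kid (r : A) : Set where
      field
        {w}    : A
        edge   : R r w
        tree   : Tree w
        proper : Proper tree
        {mark} : A
        mark∈  : mark ∈ˡ nodes tree
        μ-mark : μ mark
    open Kid

    record Kids {r} (s : Tree r) : Set where
      field
        kids   : List (Kid r)
        apart  : AllPairs (λ k l → Disjoint (nodes (tree k)) (nodes (tree l))) kids
        inside : ∀ {k} → k ∈ˡ kids → nodes (tree k) ⊆ nodes s
        root∉  : ∀ {k} → k ∈ˡ kids → r ∉ˡ nodes (tree k)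
        bound  : # s ≤ 1 + length kids * D

    -- Children without marked nodes in their subtrees are skipped. In a light tree each of the
    -- others accounts for fewer than `D` marked nodes, and the 1 in `bound` allows for the root.
    markedKids : ∀ {r} (s : Tree r) → Light s → Proper s → Kids s
    markedKids (leaf r) _ _ = record
      { kids = [] ; apart = [] ; inside = λ () ; root∉ = λ ()
      ; bound = List.length-filter μ? (r ∷ []) }
    markedKids (s ⊳ (e , t)) (ls , lt) u = add (marked t) refl
      where
      us = proj₁ (proper-⊳ s t u)
      ut = proj₁ (proj₂ (proper-⊳ s t u))
      dis = proj₂ (proj₂ (proper-⊳ s t u))
      K = markedKids s ls us
      module K = Kids K
      #≡ : # (s ⊳ (e , t)) ≡ # s + # t
      #≡ = trans (cong length (List.filter-++ μ? (nodes s) _)) (List.length-++ (marked s))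
      add : ∀ ms → marked t ≡ ms → Kids (s ⊳ (e , t))
      add [] eq = record
        { K ; inside = λ k∈ x∈ → ∈-++⁺ˡ (K.inside k∈ x∈)
        ; bound = ℕ.≤-trans (ℕ.≤-reflexive (trans #≡ (trans (cong (# s +_) (cong length eq)) (ℕ.+-identityʳ _)))) K.bound }
      add (y ∷ _) eq = record
        { kids = record { edge = e ; tree = t ; proper = ut ; mark∈ = proj₁ y∈ ; μ-mark = proj₂ y∈ } ∷ K.kids
        ; apart = All.tabulate (λ k∈ (x∈t , x∈k) → dis (K.inside k∈ x∈k , x∈t)) ∷ K.apart
        ; inside = λ { (here refl) x∈ → ∈-++⁺ʳ (nodes s) x∈ ; (there k∈) x∈ → ∈-++⁺ˡ (K.inside k∈ x∈) }
        ; root∉ = λ { (here refl) r∈ → dis (root∈ s , r∈) ; (there k∈) → K.root∉ k∈ }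
        ; bound = begin
            # (s ⊳ (e , t))               ≡⟨ #≡ ⟩
            # s + # t                     ≤⟨ ℕ.+-mono-≤ K.bound (ℕ.<⇒≤ lt) ⟩
            suc (length K.kids * D) + D   ≡⟨ cong suc (ℕ.+-comm (length K.kids * D) D) ⟩
            suc (D + length K.kids * D)   ∎ }
        where
        open ≤-Reasoning
        y∈ = ∈-filter⁻ μ? {xs = nodes t} (subst (y ∈ˡ_) (sym eq) (here refl))

    -- The nodes in `T` will be the images of the vertices of F; the marked nodes that each of them
    -- reaches outside `T` will supply the cut condition.
    record Transversal {r} (t : Tree r) (n : ℕ) : Set where
      field
        T       : List A
        T-size  : length T ≡ n
        T-uniq  : Unique T
        T⊆      : T ⊆ nodes t
        targets : ∀ {x} → x ∈ˡ T → ∃[ ds ] D ≤ length ds × Unique ds ×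
                    (∀ {y} → y ∈ˡ ds → μ y × Reach (λ z → z ∈ˡ nodes t × z ∉ˡ T) x y)
    open Transversal

    enlarge : ∀ {r c} {s : Tree c} {t : Tree r} → nodes s ⊆ nodes t →
      Transversal s n → Transversal t n
    enlarge s⊆ tr = record
      { Transversal tr ; T⊆ = s⊆ ∘ tr .T⊆
      ; targets = λ x∈ → let ds , D≤ , uds , reach = tr .targets x∈ in
          ds , D≤ , uds , λ y∈ → let m , path = reach y∈ in
          m , reach-mono (λ (z∈ , z∉) → s⊆ z∈ , z∉) path }

    -- `T` consists of the first `n` children in `kids`. Each of them reaches the marked nodes in
    -- the subtrees of the remaining ones, at least `D` in number, by going up to the root and down
    -- again.
    star : ∀ {r} (s : Tree r) (K : Kids s) → n + D ≤ length (Kids.kids K) → Transversal s n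
    star {n = n} {r} s K le = record
      { T = map w as
      ; T-size = trans (List.length-map w as)
          (trans (List.length-take n kids) (ℕ.m≤n⇒m⊓n≡m (ℕ.≤-trans (ℕ.m≤m+n n D) le)))
      ; T-uniq = AllPairs.map⁺ (AllPairs.map (λ {k} {l} dis eq →
          dis (root∈ (tree k) , subst (_∈ˡ nodes (tree l)) (sym eq) (root∈ (tree l)))) apart-as)
      ; T⊆ = λ x∈ → let k , k∈ , eq = ∈-map⁻ w x∈ in
          subst (_∈ˡ nodes s) (sym eq) (K.inside (as⊆ k∈) (root∈ (tree k)))
      ; targets = λ x∈ → let k , k∈ , eq = ∈-map⁻ w x∈ in
          map mark bs , D≤bs , AllPairs.map⁺ (AllPairs.map (λ {k} {l} dis eq →
            dis (mark∈ k , subst (_∈ˡ nodes (tree l)) (sym eq) (mark∈ l))) apart-bs) ,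
          λ y∈ → let l , l∈ , eq′ = ∈-map⁻ mark y∈ in
            subst μ (sym eq′) (μ-mark l) ,
            subst₂ (Reach _) (sym eq) (sym eq′) (
              (R-sym (edge k) , root∈ s , root∉T) ◅ (edge l , in-bs l∈ (root∈ (tree l))) ◅
              reach-mono (λ (z∈ , _) → in-bs l∈ z∈) (from-root (tree l) (proper l) (mark∈ l))) }
      where
      module K = Kids K
      kids = K.kids
      as = List.take n kids
      bs = List.drop n kids
      as++bs : as ++ bs ≡ kids
      as++bs = List.take++drop≡id n kids
      parts = AllPairs-++⁻ as (subst (AllPairs _) (sym as++bs) K.apart)
      apart-as = proj₁ parts
      apart-bs = proj₁ (proj₂ parts)
      apart-as-bs = proj₂ (proj₂ parts)
      as⊆ : as ⊆ kids
      as⊆ k∈ = subst (_ ∈ˡ_) as++bs (∈-++⁺ˡ k∈)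
      bs⊆ : bs ⊆ kids
      bs⊆ k∈ = subst (_ ∈ˡ_) as++bs (∈-++⁺ʳ as k∈)
      D≤bs : D ≤ length (map mark bs)
      D≤bs = subst (D ≤_) (sym (trans (List.length-map mark bs) (List.length-drop n kids)))
        (ℕ.+-cancelˡ-≤ n _ _ (ℕ.≤-trans le (ℕ.≤-reflexive (sym (ℕ.m+[n∸m]≡n (ℕ.≤-trans (ℕ.m≤m+n n D) le))))))
      root∉T : r ∉ˡ map w as
      root∉T r∈ with ∈-map⁻ w r∈
      ... | k , k∈ , refl = K.root∉ (as⊆ k∈) (root∈ (tree k))
      in-bs : ∀ {l z} → l ∈ˡ bs → z ∈ˡ nodes (tree l) → z ∈ˡ nodes s × z ∉ˡ map w as
      in-bs {l} {z} l∈ z∈ = K.inside (bs⊆ l∈) z∈ , z∉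
        where
        z∉ : z ∉ˡ map w as
        z∉ z∈T with ∈-map⁻ w z∈T
        ... | k , k∈ , refl = apart-as-bs k∈ l∈ (root∈ (tree k) , z∈)

    module _ (N : ℕ) where

      -- A light tree for which `markedKids` finds fewer than `N + D` children has at most
      -- `1 + (N + D) * D` marked nodes; one more forces `star` to apply.
      L : ℕ
      L = 2 + (N + D) * D

      star-L : ∀ {r} (s : Tree r) → Light s → Proper s → L ≤ # s → n ≤ N → Transversal s n
      star-L s light u L≤ n≤N = star s K (ℕ.≤-trans (ℕ.+-monoˡ-≤ D n≤N) (ℕ.≮⇒≥ λ lt →
          ℕ.<⇒≱ (s≤s (s≤s (ℕ.*-monoˡ-≤ D (ℕ.<⇒≤ lt)))) (ℕ.≤-trans L≤ (Kids.bound K))))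
        where K = markedKids s light u

      -- If `t` is light, or the heavy part has at least `L` marked nodes, a single `star` suffices.
      -- Otherwise the heavy part takes fewer than `L` marked nodes away; its root joins `T` with
      -- those nodes as targets, and the induction continues in the rest.
      transversal : ∀ n {r} (t : Tree r) → Proper t → n ≤ N → n * L ≤ # t → Transversal t n
      transversal zero t _ _ _ = record
        { T = [] ; T-size = refl ; T-uniq = [] ; T⊆ = λ () ; targets = λ () }
      transversal (suc n) t u n<N le with split t
      ... | inj₁ light = star-L t light u (ℕ.≤-trans (ℕ.m≤m+n L _) le) n<N
      ... | inj₂ record { c = c ; heavy = s ; rest = t′ ; light = light ; D≤ = D≤ ; perm = perm }
        with AllPairs-++⁻ (nodes s) (Permutation.Unique-resp-↭ (setoid A) (↭⇒↭ₛ perm) u) | L ℕ.≤? # s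
      ...   | us , ut′ , apart | yes L≤ = enlarge in-s (star-L s light us L≤ n<N)
        where
        in-s : nodes s ⊆ nodes t
        in-s x∈ = ∈-resp-↭ (↭-sym perm) (∈-++⁺ˡ x∈)
      ...   | us , ut′ , apart | no L≰ = record
        { T = c ∷ T tr
        ; T-size = cong suc (tr .T-size)
        ; T-uniq = All.tabulate (λ x∈ → apart (root∈ s) (tr .T⊆ x∈)) ∷ tr .T-uniq
        ; T⊆ = λ { (here refl) → in-s (root∈ s) ; (there x∈) → in-t′ (tr .T⊆ x∈) }
        ; targets = λ
          { (here refl) → marked s , D≤ , Unique.filter⁺ μ? us , λ y∈ →
              let y∈s , m = ∈-filter⁻ μ? {xs = nodes s} y∈ in
              m , reach-mono (λ (z∈ , z≢c) → in-s z∈ , λ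
                { (here eq) → z≢c eq ; (there z∈T) → apart z∈ (tr .T⊆ z∈T) refl }) (from-root s us y∈s)
          ; (there x∈) → let ds , D≤ds , uds , reach = tr .targets x∈ in
              ds , D≤ds , uds , λ y∈ → let m , path = reach y∈ in
              m , reach-mono (λ (z∈ , z∉) → in-t′ z∈ , λ
                { (here refl) → apart (root∈ s) z∈ refl ; (there z∈T) → z∉ z∈T }) path } }
        where
        in-s : nodes s ⊆ nodes t
        in-s x∈ = ∈-resp-↭ (↭-sym perm) (∈-++⁺ˡ x∈)
        in-t′ : nodes t′ ⊆ nodes t
        in-t′ x∈ = ∈-resp-↭ (↭-sym perm) (∈-++⁺ʳ (nodes s) x∈)
        #≡ : # t ≡ # s + # t′
        #≡ = trans (↭-length (filter-↭ μ? perm))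
          (trans (cong length (List.filter-++ μ? (nodes s) _)) (List.length-++ (marked s)))
        tr : Transversal t′ n
        tr = transversal n t′ ut′ (ℕ.<⇒≤ n<N) (ℕ.+-cancelˡ-≤ L _ _
          (ℕ.≤-trans le (ℕ.≤-trans (ℕ.≤-reflexive #≡) (ℕ.+-monoˡ-≤ _ (ℕ.<⇒≤ (ℕ.≰⇒> L≰))))))

-- Subgraphs spanned by walks

fromList : List (Fin n) → Subset n
fromList xs = Vec.tabulate λ v → does (v ∈ˡ? xs)

∈-fromList⁺ : {xs : List (Fin n)} {v : Fin n} → v ∈ˡ xs → v ∈ fromList xs
∈-fromList⁺ {xs = xs} {v} v∈ = Vec.lookup⇒[]= v _ (trans (Vec.lookup∘tabulate _ v) (dec-true (v ∈ˡ? xs) v∈))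

∈-fromList⁻ : {xs : List (Fin n)} {v : Fin n} → v ∈ fromList xs → v ∈ˡ xs
∈-fromList⁻ {xs = xs} {v} v∈ with v ∈ˡ? xs in eq
... | yes v∈xs = v∈xs
... | no v∉xs  = contradiction (trans (sym (Vec.[]=⇒lookup v∈)) (trans (Vec.lookup∘tabulate _ v) (cong does eq))) λ ()

module _ {G : Graph} where
  open Graph G hiding (V; E)

  spanned : ∀ {u u′ c} (p : Walk G u c) (q : Walk G u′ c) → Subgraph G
  spanned p q = record
    { vertices = fromList (walkVertices p ++ walkVertices q)
    ; edges    = fromList (walkEdges p ++ walkEdges q)
    ; closed   = λ {e} e∈ inc → ∈-fromList⁺ (Sum.[ (λ e∈p → ∈-++⁺ˡ (ends∈ {e = e} p e∈p inc))
                                             , (λ e∈q → ∈-++⁺ʳ (walkVertices p) (ends∈ {e = e} q e∈q inc)) ]′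
                                             (∈-++⁻ (walkEdges p) (∈-fromList⁻ e∈))) }

  spanned-connected : ∀ {u u′ c} (p : Walk G u c) (q : Walk G u′ c) →
    Subgraph.IsConnected {G} (spanned p q)
  spanned-connected {c = c} p q x∈ y∈ = to-c x∈ ◅◅ Star.reverse (λ (e , e∈ , j) → e , e∈ , joins-sym {G} {e} j) (to-c y∈)
    where
    S = spanned p q
    along : ∀ {u} (r : Walk G u c) → (∀ {e} → e ∈ˡ walkEdges r → e ∈ Subgraph.edges S) →
      ∀ {x} → x ∈ˡ walkVertices r → Star (Subgraph.Adjacent S) x c
    along nil          r⊆ (here refl) = ε
    along (step e j r) r⊆ (here refl) = (e , r⊆ (here refl) , j) ◅ along r (r⊆ ∘ there) (start∈ r)
    along (step e j r) r⊆ (there x∈)  = along r (r⊆ ∘ there) x∈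
    to-c : ∀ {x} → x ∈ Subgraph.vertices S → Star (Subgraph.Adjacent S) x c
    to-c x∈ with ∈-++⁻ (walkVertices p) (∈-fromList⁻ x∈)
    ... | inj₁ x∈p = along p (∈-fromList⁺ ∘ ∈-++⁺ˡ) x∈p
    ... | inj₂ x∈q = along q (∈-fromList⁺ ∘ ∈-++⁺ʳ (walkEdges p)) x∈q

  xpath : ∀ {X u v} (p : Walk G u v) → (∀ {y} → y ∈ˡ walkVertices p → y ≢ u → y ≢ v → y ∉ X) →
    Σ[ P ∈ XPath G X u v ] XPath.walk P ≼ p
  xpath p internal with shorten p
  ... | q , isPath , q≼p = record
    { walk = q ; isPath = isPath ; internal = internal ∘ q≼p .vertices } , q≼p

  gx-sym : ∀ {m X u v} → GXAdjacent G m X u v → GXAdjacent G m X v u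
  gx-sym adj = record
    { u∈X = v∈X ; v∈X = u∈X ; u≢v = u≢v ∘ sym
    ; paths = proj₁ ∘ back
    ; disjoint = λ {i} {j} i≢j (e∈i , e∈j) → disjoint i≢j (edges⊆ i e∈i , edges⊆ j e∈j) }
    where
    open GXAdjacent adj
    back = λ i → xpath (reverse (XPath.walk (paths i)))
      λ y∈ y≢v y≢u → XPath.internal (paths i) (reverse-vertices (XPath.walk (paths i)) y∈) y≢u y≢v
    edges⊆ : ∀ i → walkEdges (XPath.walk (proj₁ (back i))) ⊆ walkEdges (XPath.walk (paths i))
    edges⊆ i = reverse-edges (XPath.walk (paths i)) ∘ proj₂ (back i) .edges

lookup-injective : {xs : List A} → Unique xs → ∀ i j → List.lookup xs i ≡ List.lookup xs j → i ≡ j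
lookup-injective (x∉ ∷ u) zero    zero    eq = refl
lookup-injective (x∉ ∷ u) zero    (suc j) eq = contradiction eq (All.lookup x∉ (∈-lookup j))
lookup-injective (x∉ ∷ u) (suc i) zero    eq = contradiction (sym eq) (All.lookup x∉ (∈-lookup i))
lookup-injective (x∉ ∷ u) (suc i) (suc j) eq = cong suc (lookup-injective u i j eq)

⊎-all : {C : Set} {P : A → Set} (xs : List A) → (∀ {x} → x ∈ˡ xs → C ⊎ P x) → C ⊎ (∀ {x} → x ∈ˡ xs → P x)
⊎-all []       f = inj₂ λ ()
⊎-all (x ∷ xs) f with f (here refl) | ⊎-all xs (f ∘ there)
... | inj₁ c  | _        = inj₁ c
... | inj₂ px | inj₁ c   = inj₁ c
... | inj₂ px | inj₂ pxs = inj₂ λ { (here refl) → px ; (there x∈) → pxs x∈ }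

-- Immersions from a hub

module _ (F : Graph) where
  private
    module F = Graph F

  arms : ℕ
  arms = F.#E + F.#E

  -- The number `n * L` of marked nodes that `transversal` asks for, with `n` and `N` the number of
  -- vertices of F and `D` equal to `arms`.
  threshold : ℕ
  threshold = F.#V * (2 + (F.#V + arms) * arms)

module _ (F G : Graph) {m : ℕ} {X : Subset (Graph.#V G)} (arms≤m : arms F ≤ m) where
  private
    module F = Graph F
  open Graph G hiding (V; E)
  open Trees (GXAdjacent G m X) gx-sym

  record Hub {r} (τ : Tree r) (c : V G) : Set where
    field
      proper   : Proper τ
      nodes⊆X  : ∀ {v} → v ∈ˡ nodes τ → v ∈ X
      c∉       : c ∉ˡ nodes τ
      tips     : List (V G)
      uniq     : Unique tips
      tips⊆    : tips ⊆ nodes τ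
      many     : threshold F ≤ length tips
      walk     : ∀ {v} → v ∈ˡ tips → Walk G v c
      touch    : ∀ {v} (v∈ : v ∈ˡ tips) {y} → y ∈ˡ walkVertices (walk v∈) → y ∈ˡ nodes τ → y ≡ v
      disjoint : ∀ {u v} (u∈ : u ∈ˡ tips) (v∈ : v ∈ˡ tips) → u ≢ v →
                 Disjoint (walkEdges (walk u∈)) (walkEdges (walk v∈))

  module _ {r} {τ : Tree r} {c : V G} (H : Hub τ c) where
    open Hub H
    open Marked (_∈ˡ? tips) (arms F)
    open Transversal

    tr : Transversal τ F.#V
    tr = transversal F.#V F.#V τ proper ℕ.≤-refl
      (ℕ.≤-trans many (length-mono uniq λ v∈ → ∈-filter⁺ (_∈ˡ? tips) (tips⊆ v∈) v∈))

    W : Region #V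
    W v = does (v ∈ˡ? tr .T)

    W-false : ∀ {v} → v ∉ˡ tr .T → W v ≡ false
    W-false {v} = dec-false (v ∈ˡ? tr .T)

    t : V F → V G
    t i = List.lookup (tr .T) (Fin.cast (sym (tr .T-size)) i)

    t∈T : ∀ i → t i ∈ˡ tr .T
    t∈T i = ∈-lookup _

    t-injective : ∀ {i j} → t i ≡ t j → i ≡ j
    t-injective eq = trans (sym (back _)) (trans (cong (Fin.cast (tr .T-size)) (lookup-injective (tr .T-uniq) _ _ eq)) (back _))
      where
      back : ∀ i → Fin.cast (tr .T-size) (Fin.cast (sym (tr .T-size)) i) ≡ i
      back = Fin.cast-involutive (tr .T-size) (sym (tr .T-size))

    t≢c : ∀ i → t i ≢ c
    t≢c i eq = c∉ (subst (_∈ˡ nodes τ) eq (tr .T⊆ (t∈T i)))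

    s : Fin (arms F) → V G
    s i = Sum.[ t ∘ proj₁ ∘ F.ends , t ∘ proj₂ ∘ F.ends ]′ (Fin.splitAt F.#E i)

    s∈T : ∀ i → s i ∈ˡ tr .T
    s∈T i with Fin.splitAt F.#E i
    ... | inj₁ e = t∈T _
    ... | inj₂ e = t∈T _

    open Menger {G} W c

    module _ (Z : Region #V) (c∉Z : Z c ≡ false) where

      Crossed : Set
      Crossed = ∃[ a ] ∃[ b ] GXAdjacent G m X a b × Z a ≡ true × Z b ≡ false × b ∉ˡ tr .T

      advance : ∀ {x y} → Reach (λ z → z ∈ˡ nodes τ × z ∉ˡ tr .T) x y → Z x ≡ true → Crossed ⊎ Z y ≡ true
      advance ε x∈Z = inj₂ x∈Z
      advance (_◅_ {j = z} (adj , _ , z∉T) path) x∈Z with Z z in eq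
      ... | true  = advance path eq
      ... | false = inj₁ (_ , _ , adj , x∈Z , eq , z∉T)

      -- Each of the `m` paths from `a` to `b` leaves `Z`. The vertex entered at that moment is not
      -- `a`, which lies in `Z`; so it is `b` or lies outside `X`, and in both cases it is not
      -- chosen.
      crossed⇒arms≤ : Crossed → arms F ≤ boundary (allFin #E) Z
      crossed⇒arms≤ (a , b , adj , a∈Z , b∉Z , b∉T) = ℕ.≤-trans arms≤m (ℕ.≤-trans
        (ℕ.≤-reflexive (sym (List.length-tabulate {n = m} id)))
        (length≤boundary W c (λ i e → e ∈ˡ walkEdges (XPath.walk (paths i))) (Unique.allFin⁺ m)
          (λ i≢j e∈ e∈′ → gx-disjoint i≢j (e∈ , e∈′))
          λ {i} _ → let ex = exit Z (XPath.walk (paths i)) a∈Z b∉Z in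
            _ , _ , _ , ex , W-false (outside (paths i) ex) , Exit.e∈ ex))
        where
        open GXAdjacent adj using (paths) renaming (disjoint to gx-disjoint)
        outside : (p : XPath G X a b) (ex : Exit Z (XPath.walk p)) → Exit.y ex ∉ˡ tr .T
        outside p ex y∈T = XPath.internal p (Exit.y∈ ex)
          (λ y≡a → contradiction (trans (sym a∈Z) (trans (cong Z (sym y≡a)) (Exit.y∉Z ex))) λ ())
          (λ y≡b → b∉T (subst (_∈ˡ tr .T) y≡b y∈T))
          (nodes⊆X (tr .T⊆ y∈T))

      -- The walks from the nodes in `ds` to `c` all leave `Z`. They enter no chosen node there,
      -- since a walk meets the tree only at its start, which lies in `Z`.
      filled⇒arms≤ : ∀ {ds} → arms F ≤ length ds → Unique ds → (∀ {y} → y ∈ˡ ds → y ∈ˡ tips) →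
        (∀ {y} → y ∈ˡ ds → Z y ≡ true) → arms F ≤ boundary (allFin #E) Z
      filled⇒arms≤ arms≤ uds ds⊆ ds∈Z = ℕ.≤-trans arms≤
        (length≤boundary W c (λ y e → Σ[ y∈ ∈ y ∈ˡ tips ] e ∈ˡ walkEdges (walk y∈)) uds
          (λ y≢y′ (y∈ , e∈) (y′∈ , e∈′) → disjoint y∈ y′∈ y≢y′ (e∈ , e∈′))
          λ {y} y∈ → let p = walk (ds⊆ y∈) ; ex = exit Z p (ds∈Z y∈) c∉Z in
            _ , _ , p , ex , W-false (λ y∈T → outside (ds∈Z y∈) ex
              (touch (ds⊆ y∈) (Exit.y∈ ex) (tr .T⊆ y∈T))) , ds⊆ y∈ , Exit.e∈ ex)
        where
        outside : ∀ {y} {p : Walk G y c} → Z y ≡ true → (ex : Exit Z p) → Exit.y ex ≢ y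
        outside y∈Z ex eq = contradiction (trans (sym y∈Z) (trans (cong Z (sym eq)) (Exit.y∉Z ex))) λ ()

      -- If some `s i` lies in `Z`, follow the paths from it to its targets: either one of them
      -- leaves `Z` along an adjacency, or all targets lie in `Z`. Both give `arms F`, which the
      -- demand never exceeds.
      cut-condition : demand s Z ≤ boundary (allFin #E) Z
      cut-condition with Fin.any? (λ i → Z (s i) Bool.≟ true)
      ... | no none = ℕ.≤-trans (ℕ.≤-reflexive (demand≡0 s Z λ i → Bool.¬-not λ eq → none (i , eq))) z≤n
      ... | yes (i , s∈Z) = ℕ.≤-trans (demand≤ s Z)
        (let ds , arms≤ , uds , reach = tr .targets (s∈T i) in
         Sum.[ crossed⇒arms≤ , filled⇒arms≤ arms≤ uds (proj₁ ∘ reach) ]′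
           (⊎-all ds λ y∈ → advance (proj₂ (reach y∈)) s∈Z))

    routing : Routing W c s (allFin #E)
    routing = menger W c s cut-condition
    module R = Routing routing

    -- Shortened, because `cycle` needs a path to build the cycle in the image of a loop.
    arm : ∀ i → Walk G (s i) c
    arm i = proj₁ (shorten (R.walks i))

    arm≼ : ∀ i → arm i ≼ R.walks i
    arm≼ i = proj₂ (proj₂ (shorten (R.walks i)))

    arm-disjoint : ∀ {i j} → i ≢ j → Disjoint (walkEdges (arm i)) (walkEdges (arm j))
    arm-disjoint {i} {j} i≢j (e∈ , e∈′) = R.disjoint i≢j (arm≼ i .edges e∈ , arm≼ j .edges e∈′)

    -- Strongness rests on this: the walks of the routing enter no chosen node, so a chosen node on
    -- an arm can only be its start.
    arm-avoids : ∀ i {v} → t v ∈ˡ walkVertices (arm i) → t v ≡ s i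
    arm-avoids i {v} t∈ = Sum.[ id , (λ t∈′ →
        contradiction (trans (sym (dec-true (t v ∈ˡ? tr .T) (t∈T v))) (R.avoid i t∈′)) λ ()) ]′
      (∈-vertsAfter (R.walks i) (arm≼ i .vertices t∈))

    left right : E F → Fin (arms F)
    left  e = e ↑ˡ F.#E
    right e = F.#E ↑ʳ e

    s-left : ∀ e → s (left e) ≡ t (proj₁ (F.ends e))
    s-left e = cong Sum.[ _ , _ ]′ (Fin.splitAt-↑ˡ F.#E e F.#E)

    s-right : ∀ e → s (right e) ≡ t (proj₂ (F.ends e))
    s-right e = cong Sum.[ _ , _ ]′ (Fin.splitAt-↑ʳ F.#E F.#E e)

    left≢right : ∀ e f → left e ≢ right f
    left≢right e f eq with trans (sym (Fin.splitAt-↑ˡ F.#E e F.#E)) (trans (cong (Fin.splitAt F.#E) eq) (Fin.splitAt-↑ʳ F.#E F.#E f))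
    ... | ()

    image : E F → Subgraph G
    image e = spanned (arm (left e)) (arm (right e))

    image-edges : ∀ {e g} → g ∈ Subgraph.edges (image e) →
      ∃[ i ] (i ≡ left e ⊎ i ≡ right e) × g ∈ˡ walkEdges (arm i)
    image-edges {e} g∈ = Sum.[ (λ g∈l → left e , inj₁ refl , g∈l) , (λ g∈r → right e , inj₂ refl , g∈r) ]′
      (∈-++⁻ (walkEdges (arm (left e))) (∈-fromList⁻ g∈))

    arms-distinct : ∀ {e f} → e ≢ f → ∀ {i j} → i ≡ left e ⊎ i ≡ right e → j ≡ left f ⊎ j ≡ right f → i ≢ j
    arms-distinct e≢f (inj₁ refl) (inj₁ refl) eq = e≢f (Fin.↑ˡ-injective F.#E _ _ eq)
    arms-distinct e≢f (inj₁ refl) (inj₂ refl) eq = left≢right _ _ eq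
    arms-distinct e≢f (inj₂ refl) (inj₁ refl) eq = left≢right _ _ (sym eq)
    arms-distinct e≢f (inj₂ refl) (inj₂ refl) eq = e≢f (Fin.↑ʳ-injective F.#E _ _ eq)

    image-incident : ∀ {e v} → F.Incident e v → t v ∈ Subgraph.vertices (image e)
    image-incident {e} (inj₁ refl) = ∈-fromList⁺ (∈-++⁺ˡ
      (subst (_∈ˡ walkVertices (arm (left e))) (s-left e) (start∈ (arm (left e)))))
    image-incident {e} (inj₂ refl) = ∈-fromList⁺ (∈-++⁺ʳ (walkVertices (arm (left e)))
      (subst (_∈ˡ walkVertices (arm (right e))) (s-right e) (start∈ (arm (right e)))))

    image-loop : ∀ {e v} → F.Incident e v → F.IsLoop e → ContainsCycleThrough (image e) (t v)
    image-loop {e} {v} inc isLoop =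
      let C , C⊆ = cycle (trans (s-left e) (cong t (sym v≡₁))) (trans (s-right e) (cong t (sym v≡₂))) (t≢c v)
                     (arm (left e)) (arm (right e)) (proj₁ (proj₂ (shorten (R.walks (left e)))))
                     (arm-disjoint (left≢right e e))
      in C , All.tabulate λ g∈ → ∈-fromList⁺ (Sum.[ ∈-++⁺ˡ , ∈-++⁺ʳ (walkEdges (arm (left e))) ]′ (C⊆ g∈))
      where
      v≡₁ : v ≡ proj₁ (F.ends e)
      v≡₁ = Sum.[ id , (λ eq → trans eq (sym isLoop)) ]′ inc
      v≡₂ : v ≡ proj₂ (F.ends e)
      v≡₂ = trans v≡₁ isLoop

    image-strong : ∀ {e v} → ¬ F.Incident e v → t v ∉ Subgraph.vertices (image e)
    image-strong {e} ¬inc t∈ = ¬inc (Sum.map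
      (λ t∈l → t-injective (trans (arm-avoids (left e) t∈l) (s-left e)))
      (λ t∈r → t-injective (trans (arm-avoids (right e) t∈r) (s-right e)))
      (∈-++⁻ (walkVertices (arm (left e))) (∈-fromList⁻ t∈)))

    hub⇒immersion : StrongImmersion F G
    hub⇒immersion = record
      { immersion = record
        { θᵛ = t ; θᵉ = image ; injective = t-injective
        ; connected = λ e → spanned-connected (arm (left e)) (arm (right e))
        ; edgeDisjoint = λ e≢f g∈ g∈′ →
            let i , i≡ , g∈i = image-edges g∈ ; j , j≡ , g∈j = image-edges g∈′ in
            arm-disjoint (arms-distinct e≢f i≡ j≡) (g∈i , g∈j)
        ; incident = image-incident ; loop = image-loop }
      ; strong = image-strong }

-- The pigeonhole principle

length-filter-split : {P : A → Set} (P? : ∀ x → Dec (P x)) (xs : List A) →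
  length xs ≡ length (filter P? xs) + length (filter (¬? ∘ P?) xs)
length-filter-split P? [] = refl
length-filter-split P? (x ∷ xs) with P? x
... | yes _ = cong suc (length-filter-split P? xs)
... | no _  = trans (cong suc (length-filter-split P? xs)) (sym (ℕ.+-suc (length (filter P? xs)) _))

module _ (key : A → Fin n) where

  Apart : ℕ → List A → Set
  Apart p xs = ∃[ ys ] ys ⊆ xs × p ≤ length ys × AllPairs (λ x y → key x ≢ key y) ys

  Together : ℕ → List A → Set
  Together q xs = ∃[ a ] ∃[ ys ] ys ⊆ xs × q ≤ length ys × Unique ys × (∀ {y} → y ∈ˡ ys → key y ≡ a)

  -- Collect the elements that share the key of the first one. If they are fewer than `q`, keep the
  -- first one as a representative and continue with the elements that have other keys.
  pigeonhole : ∀ p {q} (xs : List A) → 1 ≤ q → Unique xs → p * q ≤ length xs → Apart p xs ⊎ Together q xs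
  pigeonhole zero xs _ _ _ = inj₁ ([] , (λ ()) , z≤n , [])
  pigeonhole (suc p) {q} [] 1≤q _ le =
    contradiction (ℕ.≤-trans 1≤q (ℕ.≤-trans (ℕ.m≤m+n q (p * q)) le)) λ ()
  pigeonhole (suc p) {q} xs@(x ∷ _) 1≤q u le = split (q ℕ.≤? length (filter same? xs))
    where
    same? : ∀ y → Dec (key y ≡ key x)
    same? y = key y Fin.≟ key x
    others = filter (¬? ∘ same?) xs
    others⊆ : ∀ {y} → y ∈ˡ others → y ∈ˡ xs × key y ≢ key x
    others⊆ = ∈-filter⁻ (¬? ∘ same?) {xs = xs}
    same⊆ : ∀ {y} → y ∈ˡ filter same? xs → y ∈ˡ xs × key y ≡ key x
    same⊆ = ∈-filter⁻ same? {xs = xs}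
    split : Dec (q ≤ length (filter same? xs)) → Apart (suc p) xs ⊎ Together q xs
    split (yes q≤) = inj₂ (key x , _ , proj₁ ∘ same⊆ , q≤ , Unique.filter⁺ same? u , proj₂ ∘ same⊆)
    split (no q≰) = Sum.map
      (λ (ys , ys⊆ , p≤ , apart) →
        x ∷ ys , (λ { (here eq) → here eq ; (there y∈) → proj₁ (others⊆ (ys⊆ y∈)) }) , s≤s p≤ ,
        All.tabulate (λ y∈ eq → proj₂ (others⊆ (ys⊆ y∈)) (sym eq)) ∷ apart)
      (λ (a , ys , ys⊆ , rest) → a , ys , proj₁ ∘ others⊆ ∘ ys⊆ , rest)
      (pigeonhole p others 1≤q (Unique.filter⁺ (¬? ∘ same?) u) (ℕ.+-cancelˡ-≤ q _ _ (begin
        q + p * q                                 ≤⟨ le ⟩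
        length xs                                 ≡⟨ length-filter-split same? xs ⟩
        length (filter same? xs) + length others  ≤⟨ ℕ.+-monoˡ-≤ _ (ℕ.<⇒≤ (ℕ.≰⇒> q≰)) ⟩
        q + length others                         ∎)))
      where open ≤-Reasoning

x∉p-x : (p : Subset n) (x : Fin n) → x ∉ p Subset.- x
x∉p-x (true  Vec.∷ p) zero    ()
x∉p-x (false Vec.∷ p) zero    ()
x∉p-x (_     Vec.∷ p) (suc x) (Vec.there x∈) = x∉p-x p x x∈

-- Growing a spanning tree

module _ {A : Set} {R : Rel A 0ℓ} (R-sym : ∀ {x y} → R x y → R y x) where
  open Trees R R-sym

  attach : ∀ {r b x} (t : Tree r) → b ∈ˡ nodes t → R b x → Σ[ t′ ∈ Tree r ] nodes t′ ↭ x ∷ nodes t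
  attach {x = x} (leaf b) (here refl) e = leaf b ⊳ (e , leaf x) , ++-comm (b ∷ []) (x ∷ [])
  attach {x = x} (s ⊳ (f , t)) b∈ e with ∈-++⁻ (nodes s) b∈
  ... | inj₁ b∈s = let s′ , perm = attach s b∈s e in s′ ⊳ (f , t) , ++⁺ʳ (nodes t) perm
  ... | inj₂ b∈t = let t′ , perm = attach t b∈t e in
    s ⊳ (f , t′) , ↭-trans (++⁺ˡ (nodes s) perm) (shifts (nodes s) (x ∷ []))

-- Edge-disjoint walks from the cut hypothesis

card≡total : (f : Fin n → Bool) (h : A → ℕ) (g : Fin n → A) → (∀ i → ⟦ f i ⟧ ≡ h (g i)) →
  ∣ Vec.tabulate f ∣ ≡ total h (tabulate g)
card≡total {zero}  f h g eq = refl
card≡total {suc n} f h g eq with f zero | eq zero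
... | true  | eq₀ = cong₂ _+_ eq₀ (card≡total (f ∘ suc) h (g ∘ suc) (eq ∘ suc))
... | false | eq₀ = cong₂ _+_ eq₀ (card≡total (f ∘ suc) h (g ∘ suc) (eq ∘ suc))

module _ {G : Graph} where
  open Graph G hiding (V; E)

  CutConnected : ℕ → Subset #V → Set
  CutConnected M X = ∀ {u v} → u ∈ X → v ∈ X → u ≢ v → ¬ SeparatedByCutBelow G M u v

  -- Menger's theorem with nothing forbidden and all `M` tokens on `u`: a set that contains `u` but
  -- not `v` has demand at most `M`, and a boundary smaller than `M` would be a separating cut.
  disjoint-walks : ∀ {M u v} → ¬ SeparatedByCutBelow G M u v →
    Σ[ p ∈ (Fin M → Walk G u v) ] (∀ {i j} → i ≢ j → Disjoint (walkEdges (p i)) (walkEdges (p j)))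
  disjoint-walks {M} {u} {v} ¬sep = Routing.walks r , Routing.disjoint r
    where
    open Menger {G} (const false) v
    size : ∀ Z → ∣ δ G (Vec.tabulate Z) ∣ ≡ boundary (allFin #E) Z
    size Z = card≡total _ (crossing Z) id λ e → xor≡ (Z (proj₁ (ends e))) (Z (proj₂ (ends e)))
      (Vec.lookup∘tabulate Z _) (Vec.lookup∘tabulate Z _)
      where
      xor≡ : ∀ a b {a′ b′} → a′ ≡ a → b′ ≡ b →
        ⟦ a′ xor b′ ⟧ ≡ ⟦ a ∧ not b ∧ not false ⟧ + ⟦ b ∧ not a ∧ not false ⟧
      xor≡ true  true  refl refl = refl
      xor≡ true  false refl refl = refl
      xor≡ false true  refl refl = refl
      xor≡ false false refl refl = refl
    bound : Bounded (demand {M} (const u)) (boundary (allFin #E))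
    bound Z v∉Z with Z u in eq
    ... | false = ℕ.≤-trans (ℕ.≤-reflexive (demand≡0 {M} (const u) Z (const eq))) z≤n
    ... | true  = ℕ.≤-trans (demand≤ {M} (const u) Z) (ℕ.≮⇒≥ λ lt → ¬sep
      ( Vec.tabulate Z
      , Vec.lookup⇒[]= u _ (trans (Vec.lookup∘tabulate Z u) eq)
      , (λ v∈ → contradiction (trans (sym (Vec.[]=⇒lookup v∈)) (trans (Vec.lookup∘tabulate Z v) v∉Z)) λ ())
      , subst (_< M) (sym (size Z)) lt ))
    r : Routing (const false) v (const u) (allFin #E)
    r = menger (const false) v (const u) bound

  -- The part of a walk from B ⊆ X to v ∈ X ∖ B after its last vertex b in B, and the
  -- initial segment of that part up to the next vertex x in X.
  record Segment (X : Subset #V) (B : List (V G)) {r v} (p : Walk G r v) : Set where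
    field
      {b x} : V G
      b∈    : b ∈ˡ B
      x∈    : x ∈ X
      x∉    : x ∉ˡ B
      tail  : Walk G b v
      tail≼ : tail ≼ p
      leave : ∀ {y} → y ∈ˡ walkVertices tail → y ∈ˡ B → y ≡ b
      seg   : Walk G b x
      seg≼  : seg ≼ p
      inner : ∀ {y} → y ∈ˡ walkVertices seg → y ∈ X → y ≡ b ⊎ y ≡ x

  -- The part after `b` is shortened to a path before the next vertex of `X` is sought. It thus
  -- never returns to `b`, its only vertex in `B`, which puts `x` outside `B`.
  segment : ∀ {X B r v} (p : Walk G r v) → r ∈ˡ B → v ∈ X → v ∉ˡ B → Segment X B p
  segment {X} {B} {v = v} p r∈B v∈X v∉B with afterLast (_∈ˡ? B) p r∈B v∉B
  ... | b , q , b∈B , q≼p , last with shorten q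
  ...   | nil , _ , _ = contradiction b∈B v∉B
  ...   | step e j q′ , b∉ ∷ _ , path≼q with untilFirst (Subset._∈? X) q′ v∈X
  ...     | x , s , x∈X , s≼q′ , first = record
    { b∈ = b∈B ; x∈ = x∈X
    ; x∉ = λ x∈B → let x∈q′ = s≼q′ .vertices (end∈ s) in
        All.lookup b∉ x∈q′ (sym (last (path≼q .vertices (there x∈q′)) x∈B))
    ; tail = step e j q′ ; tail≼ = ≼-trans path≼q q≼p
    ; leave = last ∘ path≼q .vertices
    ; seg = step e j s ; seg≼ = ≼-trans (step-≼ s≼q′) (≼-trans path≼q q≼p)
    ; inner = λ { (here eq) _ → inj₁ eq ; (there y∈) y∈X → inj₂ (first y∈ y∈X) } }

-- The induction

module _ (F G : Graph) {m : ℕ} {X : Subset (Graph.#V G)} (arms≤m : arms F ≤ m) where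
  open Graph G hiding (V; E)
  open Trees (GXAdjacent G m X) gx-sym

  -- Turns walks indexed by `I` into walks indexed by their starts, as `Hub` asks for; the index is
  -- recovered from the proof of membership in `map b is`.
  hub : ∀ {I : Set} {r} {τ : Tree r} {c : V G} → Proper τ → (∀ {v} → v ∈ˡ nodes τ → v ∈ X) → c ∉ˡ nodes τ →
    (is : List I) (b : I → V G) → AllPairs (λ i j → b i ≢ b j) is → threshold F ≤ length is →
    (∀ {i} → i ∈ˡ is → b i ∈ˡ nodes τ) →
    (w : ∀ {i} → i ∈ˡ is → Walk G (b i) c) →
    (∀ {i} (i∈ : i ∈ˡ is) {y} → y ∈ˡ walkVertices (w i∈) → y ∈ˡ nodes τ → y ≡ b i) →
    (∀ {i j} (i∈ : i ∈ˡ is) (j∈ : j ∈ˡ is) → i ≢ j → Disjoint (walkEdges (w i∈)) (walkEdges (w j∈))) →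
    Hub F G arms≤m τ c
  hub {I} {τ = τ} {c} proper nodes⊆X c∉ is b apart many b∈ w touch disjoint = record
    { proper = proper ; nodes⊆X = nodes⊆X ; c∉ = c∉
    ; tips = map b is
    ; uniq = AllPairs.map⁺ apart
    ; tips⊆ = λ v∈ → let i , i∈ , eq = ∈-map⁻ b v∈ in subst (_∈ˡ nodes τ) (sym eq) (b∈ i∈)
    ; many = subst (threshold F ≤_) (sym (List.length-map b is)) many
    ; walk = walk ∘ ∈-map⁻ b
    ; touch = touch′ ∘ ∈-map⁻ b
    ; disjoint = λ u∈ v∈ → disjoint′ (∈-map⁻ b u∈) (∈-map⁻ b v∈) }
    where
    Tip = λ v → ∃[ i ] i ∈ˡ is × v ≡ b i
    walk : ∀ {v} → Tip v → Walk G v c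
    walk (_ , i∈ , refl) = w i∈
    touch′ : ∀ {v} (t : Tip v) {y} → y ∈ˡ walkVertices (walk t) → y ∈ˡ nodes τ → y ≡ v
    touch′ (_ , i∈ , refl) = touch i∈
    disjoint′ : ∀ {u v} (t : Tip u) (t′ : Tip v) → u ≢ v → Disjoint (walkEdges (walk t)) (walkEdges (walk t′))
    disjoint′ (_ , i∈ , refl) (_ , j∈ , refl) u≢v = disjoint i∈ j∈ (u≢v ∘ cong b)

record SpanningTree (G : Graph) (m : ℕ) (X : Subset (Graph.#V G)) (r : V G) : Set where
  open Trees (GXAdjacent G m X) gx-sym
  field
    tree   : Tree r
    proper : Proper tree
    ⊆X     : ∀ {v} → v ∈ˡ nodes tree → v ∈ X
    X⊆     : ∀ {v} → v ∈ X → v ∈ˡ nodes tree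

module _ (F : Graph) (m : ℕ) where

  -- Tree edges stand for this many paths, so that at least as many arms as F needs can cross them.
  width : ℕ
  width = suc (m + arms F)

  -- The successor ensures that a list of at least `K` indices is nonempty, so that a vertex can be
  -- read off from its head.
  K : ℕ
  K = suc (threshold F)

  -- Enough for two rounds of the pigeonhole principle: `K` different exits `b` or many walks with
  -- the same `b`, and among the latter `K` different entries `x` or `width` walks with the same
  -- `x`.
  M : ℕ
  M = K * (K * width)

  arms≤width : arms F ≤ width
  arms≤width = ℕ.m≤n⇒m≤1+n (ℕ.m≤n+m (arms F) m)

  module _ (G : Graph) where
    open Graph G hiding (V; E)

    Spannable : Subset #V → Set
    Spannable X = ∀ r → r ∈ X → StrongImmersion F G ⊎ SpanningTree G width X r

    module _ (X : Subset #V) (conn : CutConnected {G} M X)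
             (ih : ∀ b → b ∈ X → Spannable (X Subset.- b)) where
      open Trees (GXAdjacent G width X) gx-sym

      Extension : ∀ {r} → Tree r → Set
      Extension τ = ∃[ b ] ∃[ x ] b ∈ˡ nodes τ × x ∉ˡ nodes τ × GXAdjacent G width X b x

      module _ {r} (τ : Tree r) (proper : Proper τ) (τ⊆X : ∀ {v} → v ∈ˡ nodes τ → v ∈ X)
               {v} (v∉τ : v ∉ˡ nodes τ) {N} (walk : Fin N → Walk G r v)
               (disjoint : ∀ {i j} → i ≢ j → Disjoint (walkEdges (walk i)) (walkEdges (walk j)))
               (segments : ∀ i → Segment X (nodes τ) (walk i)) where

        module S i = Segment (segments i)

        x≢b : ∀ i → S.x i ≢ S.b i
        x≢b i eq = S.x∉ i (subst (_∈ˡ nodes τ) (sym eq) (S.b∈ i))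

        exits-apart : ∀ {is} → AllPairs (λ i j → S.b i ≢ S.b j) is → K ≤ length is → StrongImmersion F G
        exits-apart {is} apart K≤ = hub⇒immersion F G arms≤width
          (hub F G arms≤width {τ = τ} proper τ⊆X v∉τ is S.b apart (ℕ.<⇒≤ K≤) (λ {i} _ → S.b∈ i) (λ {i} _ → S.tail i)
            (λ {i} _ → S.leave i)
            λ {i} {j} _ _ i≢j (e∈ , e∈′) → disjoint i≢j (S.tail≼ i .edges e∈ , S.tail≼ j .edges e∈′))

        -- Here the hub is b, and the tree spans X − b.
        entries-apart : ∀ {b is} → (∀ {i} → i ∈ˡ is → S.b i ≡ b) →
          AllPairs (λ i j → S.x i ≢ S.x j) is → K ≤ length is → StrongImmersion F G
        entries-apart {b} {is@(i₀ ∷ _)} at-b apart K≤ = finish (ih b b∈X (S.x i₀) (x∈ (here refl)))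
          where
          b∈X : b ∈ X
          b∈X = subst (_∈ X) (at-b (here refl)) (τ⊆X (S.b∈ i₀))
          x∈ : ∀ {i} → i ∈ˡ is → S.x i ∈ X Subset.- b
          x∈ {i} i∈ = Subset.x∈p∧x≢y⇒x∈p-y (S.x∈ i) (λ eq → x≢b i (trans eq (sym (at-b i∈))))
          back : ∀ {i} → i ∈ˡ is → Walk G (S.x i) b
          back {i} i∈ = subst (Walk G (S.x i)) (at-b i∈) (reverse (S.seg i))
          back≼ : ∀ {i} (i∈ : i ∈ˡ is) → back i∈ ≼ S.seg i
          back≼ {i} i∈ = subst-≼ (at-b i∈)
            where
            subst-≼ : ∀ {b} (eq : S.b i ≡ b) → subst (Walk G (S.x i)) eq (reverse (S.seg i)) ≼ S.seg i
            subst-≼ refl = reverse-≼ (S.seg i)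
          finish : StrongImmersion F G ⊎ SpanningTree G width (X Subset.- b) (S.x i₀) → StrongImmersion F G
          finish (inj₁ imm) = imm
          finish (inj₂ st) = hub⇒immersion F G arms≤width
            (hub F G arms≤width {τ = T.tree} T.proper T.⊆X (x∉p-x X b ∘ T.⊆X) is S.x apart (ℕ.<⇒≤ K≤) (T.X⊆ ∘ x∈) back
              -- A segment meets `X` only in its ends, and the end `b` is missing from the tree.
              (λ {i} i∈ {y} y∈ y∈T → Sum.[
                  (λ eq → contradiction (subst (_∈ X Subset.- b) (trans eq (at-b i∈)) (T.⊆X y∈T)) (x∉p-x X b)) , id ]′
                (S.inner i (back≼ i∈ .vertices y∈) (Subset.p─q⊆p X _ (T.⊆X y∈T))))
              λ {i} {j} i∈ j∈ i≢j (e∈ , e∈′) → disjoint i≢j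
                (S.seg≼ i .edges (back≼ i∈ .edges e∈) , S.seg≼ j .edges (back≼ j∈ .edges e∈′)))
            where module T = SpanningTree st

        -- The segments are edge-disjoint and meet `X` only in their ends, so `width` of them with
        -- common ends yield the paths of an adjacency.
        parallel : ∀ {b x is} → (∀ {i} → i ∈ˡ is → S.b i ≡ b × S.x i ≡ x) → Unique is → width ≤ length is →
          Extension τ
        parallel {b} {x} {is@(i₀ ∷ _)} at u width≤ = b , x ,
          subst (_∈ˡ nodes τ) (proj₁ (at (here refl))) (S.b∈ i₀) ,
          subst (_∉ˡ nodes τ) (proj₂ (at (here refl))) (S.x∉ i₀) ,
          record
            { u∈X = subst (_∈ X) (proj₁ (at (here refl))) (τ⊆X (S.b∈ i₀))
            ; v∈X = subst (_∈ X) (proj₂ (at (here refl))) (S.x∈ i₀)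
            ; u≢v = λ eq → x≢b i₀ (trans (proj₂ (at (here refl))) (trans (sym eq) (sym (proj₁ (at (here refl))))))
            ; paths = λ k → proj₁ (path k)
            ; disjoint = λ {k} {l} k≢l (e∈ , e∈′) → disjoint
                (k≢l ∘ Fin.inject≤-injective width≤ width≤ k l ∘ lookup-injective u _ _)
                (S.seg≼ _ .edges (proj₂ (path k) e∈) , S.seg≼ _ .edges (proj₂ (path l) e∈′)) }
          where
          index : Fin width → Fin N
          index k = List.lookup is (Fin.inject≤ k width≤)
          between : ∀ i {b x} → S.b i ≡ b → S.x i ≡ x →
            Σ[ P ∈ XPath G X b x ] walkEdges (XPath.walk P) ⊆ walkEdges (S.seg i)
          between i refl refl = let P , P≼ = xpath (S.seg i) (λ y∈ y≢b y≢x y∈X → Sum.[ y≢b , y≢x ]′ (S.inner i y∈ y∈X))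
                                in P , P≼ .edges
          path : ∀ k → Σ[ P ∈ XPath G X b x ] walkEdges (XPath.walk P) ⊆ walkEdges (S.seg (index k))
          path k = let b≡ , x≡ = at (∈-lookup (Fin.inject≤ k width≤)) in between (index k) b≡ x≡

        many-segments : K * (K * width) ≤ N → StrongImmersion F G ⊎ Extension τ
        many-segments le = Sum.[
            (λ (_ , _ , K≤ , apart) → inj₁ (exits-apart apart K≤)) ,
            (λ (_ , is , _ , le′ , u , at-b) → Sum.[
                (λ (_ , js⊆ , K≤ , apart) → inj₁ (entries-apart (at-b ∘ js⊆) apart K≤)) ,
                (λ (_ , _ , js⊆ , width≤ , u′ , at-x) → inj₂ (parallel (λ j∈ → at-b (js⊆ j∈) , at-x j∈) u′ width≤)) ]′
              (pigeonhole S.x K is (s≤s z≤n) u le′)) ]′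
          (pigeonhole S.b K (allFin N) (s≤s z≤n) (Unique.allFin⁺ N)
            (ℕ.≤-trans le (ℕ.≤-reflexive (sym (List.length-tabulate {n = N} id)))))

      extension : ∀ {r} (τ : Tree r) → Proper τ → (∀ {v} → v ∈ˡ nodes τ → v ∈ X) →
        ∀ {v} → v ∈ X → v ∉ˡ nodes τ → StrongImmersion F G ⊎ Extension τ
      extension τ proper τ⊆X v∈X v∉τ =
        let walk , disjoint = disjoint-walks (conn (τ⊆X (root∈ τ)) v∈X λ { refl → v∉τ (root∈ τ) }) in
        many-segments τ proper τ⊆X v∉τ walk disjoint
          (λ i → segment (walk i) (root∈ τ) v∈X v∉τ) ℕ.≤-refl

      -- Every extension adds a node and uses one unit of fuel. The nodes are distinct and hence at
      -- most `#V` in number, so the fuel cannot run out while a vertex of `X` is missing.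
      grow : ∀ fuel {r} (τ : Tree r) → Proper τ → (∀ {v} → v ∈ˡ nodes τ → v ∈ X) →
        suc #V ≤ fuel + length (nodes τ) → StrongImmersion F G ⊎ SpanningTree G width X r
      grow fuel τ proper τ⊆X le with Fin.any? (λ v → (v Subset.∈? X) ×-dec ¬? (v ∈ˡ? nodes τ))
      ... | no none = inj₂ record { tree = τ ; proper = proper ; ⊆X = τ⊆X ; X⊆ = X⊆ }
        where
        X⊆ : ∀ {v} → v ∈ X → v ∈ˡ nodes τ
        X⊆ {v} v∈X with v ∈ˡ? nodes τ
        ... | yes v∈ = v∈
        ... | no v∉ = contradiction (v , v∈X , v∉) none
      grow zero τ proper τ⊆X le | yes _ = contradiction
        (ℕ.≤-trans (length-mono proper (λ {v} _ → ∈-allFin v)) (ℕ.≤-reflexive (List.length-tabulate id))) (ℕ.<⇒≱ le)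
      grow (suc fuel) τ proper τ⊆X le | yes (v , v∈X , v∉τ) with extension τ proper τ⊆X v∈X v∉τ
      ... | inj₁ imm = inj₁ imm
      ... | inj₂ (b , x , b∈ , x∉ , adj) with attach gx-sym τ b∈ adj
      ...   | τ′ , perm = grow fuel τ′
        (Permutation.Unique-resp-↭ (setoid (V G)) (↭⇒↭ₛ (↭-sym perm)) (All.tabulate (λ y∈ → λ { refl → x∉ y∈ }) ∷ proper))
        (λ y∈ → in-X (∈-resp-↭ perm y∈))
        (ℕ.≤-trans le (ℕ.≤-reflexive (trans (sym (ℕ.+-suc fuel _)) (cong (fuel +_) (sym (↭-length perm))))))
        where
        in-X : ∀ {y} → y ∈ˡ x ∷ nodes τ → y ∈ X
        in-X (here refl) = GXAdjacent.v∈X adj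
        in-X (there y∈)  = τ⊆X y∈

      spannable : Spannable X
      spannable r r∈X = grow #V (leaf r) ([] ∷ []) (λ { (here refl) → r∈X })
        (ℕ.≤-reflexive (ℕ.+-comm 1 #V))

    -- Cuts are taken in `G`, so the cut condition is inherited when `b` is dropped from `X`, and
    -- the induction on the size goes through.
    cut-connected⇒spannable : ∀ size X → ∣ X ∣ ≤ size → CutConnected {G} M X → Spannable X
    cut-connected⇒spannable size X le conn = spannable X conn (smaller size le)
      where
      smaller : ∀ size → ∣ X ∣ ≤ size → ∀ b → b ∈ X → Spannable (X Subset.- b)
      smaller zero le b b∈ = contradiction (ℕ.≤-trans (Subset.x∈p⇒∣p-x∣<∣p∣ b∈) le) λ ()
      smaller (suc size) le b b∈ = cut-connected⇒spannable size (X Subset.- b)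
        (ℕ.≤-pred (ℕ.≤-trans (Subset.x∈p⇒∣p-x∣<∣p∣ b∈) le))
        (λ u∈ v∈ → conn (Subset.p─q⊆p X _ u∈) (Subset.p─q⊆p X _ v∈))

-- From the spanning tree to connectedness

gx-fewer : ∀ {G m m′ X u v} → m ≤ m′ → GXAdjacent G m′ X u v → GXAdjacent G m X u v
gx-fewer m≤m′ adj = record
  { u∈X = u∈X ; v∈X = v∈X ; u≢v = u≢v
  ; paths = λ i → paths (Fin.inject≤ i m≤m′)
  ; disjoint = λ i≢j → disjoint (i≢j ∘ Fin.inject≤-injective m≤m′ m≤m′ _ _) }
  where open GXAdjacent adj

theorem6 : (F : Graph) (m : ℕ) →
    ∃[ M ] ((G : Graph) (X : Subset (Graph.#V G)) →
    (∀ {u v} → u ∈ X → v ∈ X → u ≢ v → ¬ SeparatedByCutBelow G M u v) →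
    ¬ StrongImmersion F G →
    GXConnected G m X)
theorem6 F m = M F m , connected
  where
  connected : (G : Graph) (X : Subset (Graph.#V G)) →
    (∀ {u v} → u ∈ X → v ∈ X → u ≢ v → ¬ SeparatedByCutBelow G (M F m) u v) →
    ¬ StrongImmersion F G → GXConnected G m X
  connected G X conn ¬imm {u} {v} u∈X v∈X
    with cut-connected⇒spannable F m G ∣ X ∣ X ℕ.≤-refl conn u u∈X
  ... | inj₁ imm = contradiction imm ¬imm
  -- The tree has root `u`, so its path to `v` consists of adjacencies with `width F m` paths each,
  -- of which `m` are kept.
  ... | inj₂ st = Star.map (λ (adj , _) → gx-fewer (ℕ.m≤n⇒m≤1+n (ℕ.m≤m+n m (arms F))) adj)
    (from-root tree proper (X⊆ v∈X))
    where
    open SpanningTree st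
    open Trees (GXAdjacent G (width F m) X) gx-sym
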